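{- Let $n>2$ and $q>0$ be integers such that $n$ is even or $q$ is odd. Then for every prime $p>\max\{n,(q-1)n+1\}$, $$\sum_{k=0}^{p-1}\frac{(q-\frac{p}{n})_k^n}{(1)_k^n}\equiv 0\pmod{p^3}.$$
   Context: For a number $x$ and integer $k\ge0$, $(x)_k$ denotes the Pochhammer symbol: $(x)_0=1$ and $(x)_k=x(x+1)\cdots(x+k-1)$ for $k>0$. For rational numbers $a,b$ and a prime $p$, $a\equiv b\pmod{p^m}$ means that $a-b=p^m c$ for some rational number $c$ whose denominator is not divisible by $p$. -}

module Defs where

open import Data.Nat as ℕ using (ℕ; zero; suc)
open import Data.Nat.Divisibility using (_∣_)
open import Data.Integer using (+_)
open import Data.Rational using (ℚ; 0ℚ; 1ℚ; _+_; _-_; _*_; _/_; 1/_; ↥_; ↧ₙ_; ≢-nonZero)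
open import Data.Rational.Properties using (_≟_)
open import Data.Product using (∃; _×_)
open import Relation.Nullary using (¬_; yes; no)
open import Relation.Binary.PropositionalEquality using (_≡_)

ℕ→ℚ : ℕ → ℚ
ℕ→ℚ m = + m / 1

-- multiplicative inverse (with 1/0 := 0; only applied to nonzero values below)
inv : ℚ → ℚ
inv x with x ≟ 0ℚ
... | yes _ = 0ℚ
... | no x≢0 = 1/_ x {{≢-nonZero x≢0}}

_÷_ : ℚ → ℚ → ℚ
a ÷ b = a * inv b

_^_ : ℚ → ℕ → ℚ
x ^ zero = 1ℚ
x ^ suc m = x * (x ^ m)

poch : ℚ → ℕ → ℚ
poch x zero = 1ℚ
poch x (suc k) = poch x k * (x + ℕ→ℚ k)

sumTo : ℕ → (ℕ → ℚ) → ℚ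
sumTo zero f = 0ℚ
sumTo (suc m) f = sumTo m f + f m

_≡_[mod_^_] : ℚ → ℚ → ℕ → ℕ → Set
a ≡ b [mod p ^ m ] = ∃ λ (c : ℚ) → (a - b ≡ (ℕ→ℚ p ^ m) * c) × ¬ (p ∣ ↧ₙ c)

{-# OPTIONS --safe #-}

-- Put x = p/n, m = q - 1, M = p - q, and write a_k = (q)_k/k!, a polynomial in k of degree m.
-- For k > M the factor p - x of (q - x)_k is divisible by p, so the n-th power vanishes mod p³.
-- For k ≤ M, expanding (u - x)^n ≡ u^(n-1) (u - p) (1 + c p²/u²) factor by factor gives
--   ((q - x)_k/k!)^n ≡ a_k^(n-1) · (q - p)_k/k! · (1 + c p² h_k)  (mod p³),  h_k = Σ_{j<k} 1/(q+j)².
-- The main part Σ_k (-1)^k C(M,k) a_k^(n-1) is an M-th finite difference of a polynomial of degree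
-- m(n-1) < M, hence exactly 0. It remains to see that Σ_{k≤M} a_k^n h_k ≡ 0 (mod p). Under k ↦ M - k
-- the weight a_k^n is invariant mod p (this uses the parity hypothesis), while h_k + h_{M-k} is, up to
-- a constant, Σ_{1≤i≤m} 1/(k+i)², whose denominators are cancelled by a_k^n. So twice the sum is
-- congruent to a sum over all residues k of a polynomial of degree at most mn < p - 1, which is 0 mod p.
module Submission where

open import Defs
open import Data.Nat using (ℕ; zero; suc; _<_; _≤_; _∸_; _⊔_; s≤s; z≤n)
import Data.Nat as ℕ
import Data.Nat.Properties as ℕ
open import Data.Nat.Coprimality as Coprime using (Coprime; coprime-divisor)
open import Data.Nat.Divisibility using (_∣_; _∣?_; divides; ∣-trans; ∣⇒≤; ∣1⇒≡1; ∣m+n∣m⇒∣n; ∣m∣n⇒∣m+n; ∣-refl)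
open import Data.Nat.Primality using (Prime; euclidsLemma; prime⇒irreducible; prime⇒nonTrivial)
open import Data.Integer using (ℤ)
import Data.Integer as ℤ
import Data.Integer.Properties as ℤ
open import Data.Maybe using (Maybe; just; nothing)
open import Data.Product using (_,_)
open import Data.Rational using (ℚ; mkℚ; 0ℚ; 1ℚ; _+_; _-_; _*_; -_; _/_; ↥_; ↧ₙ_; toℚᵘ; ≢-nonZero)
open import Data.Rational.Properties
open import Data.Rational.Unnormalised using (mkℚᵘ; *≡*)
import Data.Rational.Unnormalised as ℚᵘ
import Data.Rational.Unnormalised.Properties as ℚᵘ
open import Data.Sum using (_⊎_; inj₁; inj₂)
open import Relation.Binary.Bundles using (Setoid)
open import Relation.Binary.PropositionalEquality
open import Relation.Nullary using (¬_; yes; no; contradiction)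
open import Tactic.RingSolver using (solve-∀)
open import Tactic.RingSolver.Core.AlmostCommutativeRing using (AlmostCommutativeRing; fromCommutativeRing)

-- Rational arithmetic: the embedding of the integers, inverses and powers.

ℚ-ring : AlmostCommutativeRing _ _
ℚ-ring = fromCommutativeRing +-*-commutativeRing isZero
  where
  isZero : ∀ x → Maybe (0ℚ ≡ x)
  isZero x with 0ℚ ≟ x
  ... | yes 0≡x = just 0≡x
  ... | no _ = nothing

ℤ→ℚ : ℤ → ℚ
ℤ→ℚ i = i / 1

-- Normalisation hides a gcd computation in `i / 1`, so the identity is checked on unnormalised
-- fractions, where cross multiplication with denominators 1 settles it.
ℤ→ℚ-+ : ∀ i j → ℤ→ℚ (i ℤ.+ j) ≡ ℤ→ℚ i + ℤ→ℚ j
ℤ→ℚ-+ i j = toℚᵘ-injective (begin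
  toℚᵘ (ℤ→ℚ (i ℤ.+ j))                ≈⟨ toℚᵘ-fromℚᵘ (mkℚᵘ (i ℤ.+ j) 0) ⟩
  mkℚᵘ (i ℤ.+ j) 0                    ≈⟨ *≡* (cong (ℤ._* ℤ.+ 1) (sym (cong₂ ℤ._+_ (ℤ.*-identityʳ i) (ℤ.*-identityʳ j)))) ⟩
  mkℚᵘ i 0 ℚᵘ.+ mkℚᵘ j 0              ≈⟨ ℚᵘ.+-cong (toℚᵘ-fromℚᵘ (mkℚᵘ i 0)) (toℚᵘ-fromℚᵘ (mkℚᵘ j 0)) ⟨
  toℚᵘ (ℤ→ℚ i) ℚᵘ.+ toℚᵘ (ℤ→ℚ j)      ≈⟨ toℚᵘ-homo-+ (ℤ→ℚ i) (ℤ→ℚ j) ⟨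
  toℚᵘ (ℤ→ℚ i + ℤ→ℚ j)                ∎)
  where open import Relation.Binary.Reasoning.Setoid ℚᵘ.≃-setoid

ℤ→ℚ-* : ∀ i j → ℤ→ℚ (i ℤ.* j) ≡ ℤ→ℚ i * ℤ→ℚ j
ℤ→ℚ-* i j = toℚᵘ-injective (begin
  toℚᵘ (ℤ→ℚ (i ℤ.* j))                ≈⟨ toℚᵘ-fromℚᵘ (mkℚᵘ (i ℤ.* j) 0) ⟩
  mkℚᵘ i 0 ℚᵘ.* mkℚᵘ j 0              ≈⟨ ℚᵘ.*-cong (toℚᵘ-fromℚᵘ (mkℚᵘ i 0)) (toℚᵘ-fromℚᵘ (mkℚᵘ j 0)) ⟨
  toℚᵘ (ℤ→ℚ i) ℚᵘ.* toℚᵘ (ℤ→ℚ j)      ≈⟨ toℚᵘ-homo-* (ℤ→ℚ i) (ℤ→ℚ j) ⟨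
  toℚᵘ (ℤ→ℚ i * ℤ→ℚ j)                ∎)
  where open import Relation.Binary.Reasoning.Setoid ℚᵘ.≃-setoid

ℤ→ℚ-injective : ∀ {i j} → ℤ→ℚ i ≡ ℤ→ℚ j → i ≡ j
ℤ→ℚ-injective {i} {j} eq with fromℚᵘ-injective {mkℚᵘ i 0} {mkℚᵘ j 0} eq
... | *≡* i*1≡j*1 = trans (sym (ℤ.*-identityʳ i)) (trans i*1≡j*1 (ℤ.*-identityʳ j))

ℕ→ℚ-+ : ∀ a b → ℕ→ℚ (a ℕ.+ b) ≡ ℕ→ℚ a + ℕ→ℚ b
ℕ→ℚ-+ a b = ℤ→ℚ-+ (ℤ.+ a) (ℤ.+ b)

ℕ→ℚ-* : ∀ a b → ℕ→ℚ (a ℕ.* b) ≡ ℕ→ℚ a * ℕ→ℚ b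
ℕ→ℚ-* a b = trans (cong ℤ→ℚ (ℤ.pos-* a b)) (ℤ→ℚ-* (ℤ.+ a) (ℤ.+ b))

ℕ→ℚ-suc : ∀ a → ℕ→ℚ (suc a) ≡ 1ℚ + ℕ→ℚ a
ℕ→ℚ-suc a = ℕ→ℚ-+ 1 a

ℕ→ℚ-≢0 : ∀ a → ℕ→ℚ (suc a) ≢ 0ℚ
ℕ→ℚ-≢0 a eq with ℤ→ℚ-injective {ℤ.+ suc a} {ℤ.+ 0} eq
... | ()

inv-inverseʳ : ∀ {x} → x ≢ 0ℚ → x * inv x ≡ 1ℚ
inv-inverseʳ {x} x≢0 with x ≟ 0ℚ
... | yes x≡0 = contradiction x≡0 x≢0
... | no x≢0′ = *-inverseʳ x {{≢-nonZero x≢0′}}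

recip : ℕ → ℚ
recip a = inv (ℕ→ℚ a)

recip-inverse : ∀ a → ℕ→ℚ (suc a) * recip (suc a) ≡ 1ℚ
recip-inverse a = inv-inverseʳ (ℕ→ℚ-≢0 a)

÷-unique : ∀ {x y z} → z ≢ 0ℚ → y * z ≡ x → x ÷ z ≡ y
÷-unique {x} {y} {z} z≢0 yz≡x = begin
  x * inv z         ≡⟨ cong (_* inv z) (sym yz≡x) ⟩
  y * z * inv z     ≡⟨ *-assoc y z (inv z) ⟩
  y * (z * inv z)   ≡⟨ cong (y *_) (inv-inverseʳ z≢0) ⟩
  y * 1ℚ            ≡⟨ *-identityʳ y ⟩
  y                 ∎
  where open ≡-Reasoning

*-≢0 : ∀ {x y} → x ≢ 0ℚ → y ≢ 0ℚ → x * y ≢ 0ℚ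
*-≢0 {x} {y} x≢0 y≢0 xy≡0 = y≢0 (begin
  y                   ≡⟨ *-identityˡ y ⟨
  1ℚ * y              ≡⟨ cong (_* y) (inv-inverseʳ x≢0) ⟨
  x * inv x * y       ≡⟨ comm x (inv x) y ⟩
  inv x * (x * y)     ≡⟨ cong (inv x *_) xy≡0 ⟩
  inv x * 0ℚ          ≡⟨ *-zeroʳ (inv x) ⟩
  0ℚ                  ∎)
  where
  open ≡-Reasoning
  comm : ∀ a b c → a * b * c ≡ b * (a * c)
  comm = solve-∀ ℚ-ring

^-≢0 : ∀ {x} m → x ≢ 0ℚ → x ^ m ≢ 0ℚ
^-≢0 zero x≢0 ()
^-≢0 (suc m) x≢0 = *-≢0 x≢0 (^-≢0 m x≢0)

^-distrib-* : ∀ x y m → (x * y) ^ m ≡ x ^ m * y ^ m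
^-distrib-* x y zero = refl
^-distrib-* x y (suc m) = trans (cong (x * y *_) (^-distrib-* x y m)) (lemma x y (x ^ m) (y ^ m))
  where
  lemma : ∀ x y a b → x * y * (a * b) ≡ x * a * (y * b)
  lemma = solve-∀ ℚ-ring

1^ : ∀ m → 1ℚ ^ m ≡ 1ℚ
1^ zero = refl
1^ (suc m) = trans (*-identityˡ _) (1^ m)

-- Finite sums.

sumTo-cong : ∀ N {f g : ℕ → ℚ} → (∀ k → k < N → f k ≡ g k) → sumTo N f ≡ sumTo N g
sumTo-cong zero eq = refl
sumTo-cong (suc N) eq = cong₂ _+_ (sumTo-cong N λ k k<N → eq k (ℕ.m<n⇒m<1+n k<N)) (eq N ℕ.≤-refl)

sumTo-+ : ∀ N (f g : ℕ → ℚ) → sumTo N (λ k → f k + g k) ≡ sumTo N f + sumTo N g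
sumTo-+ zero f g = refl
sumTo-+ (suc N) f g = trans (cong (_+ (f N + g N)) (sumTo-+ N f g)) (lemma (sumTo N f) (sumTo N g) (f N) (g N))
  where
  lemma : ∀ a b c d → a + b + (c + d) ≡ a + c + (b + d)
  lemma = solve-∀ ℚ-ring

sumTo-*ˡ : ∀ N c (f : ℕ → ℚ) → sumTo N (λ k → c * f k) ≡ c * sumTo N f
sumTo-*ˡ zero c f = sym (*-zeroʳ c)
sumTo-*ˡ (suc N) c f = trans (cong (_+ c * f N) (sumTo-*ˡ N c f)) (sym (*-distribˡ-+ c (sumTo N f) (f N)))

sumTo-head : ∀ N (f : ℕ → ℚ) → sumTo (suc N) f ≡ f 0 + sumTo N (λ k → f (suc k))
sumTo-head zero f = +-comm 0ℚ (f 0)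
sumTo-head (suc N) f = trans (cong (_+ f (suc N)) (sumTo-head N f)) (+-assoc (f 0) _ _)

sumTo-split : ∀ a b (f : ℕ → ℚ) → sumTo (a ℕ.+ b) f ≡ sumTo a f + sumTo b (λ k → f (a ℕ.+ k))
sumTo-split a zero f = trans (cong (λ i → sumTo i f) (ℕ.+-identityʳ a)) (sym (+-identityʳ _))
sumTo-split a (suc b) f = begin
  sumTo (a ℕ.+ suc b) f                                             ≡⟨ cong (λ i → sumTo i f) (ℕ.+-suc a b) ⟩
  sumTo (a ℕ.+ b) f + f (a ℕ.+ b)                                   ≡⟨ cong (_+ f (a ℕ.+ b)) (sumTo-split a b f) ⟩
  sumTo a f + sumTo b (λ k → f (a ℕ.+ k)) + f (a ℕ.+ b)             ≡⟨ +-assoc (sumTo a f) (sumTo b (λ k → f (a ℕ.+ k))) (f (a ℕ.+ b)) ⟩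
  sumTo a f + (sumTo b (λ k → f (a ℕ.+ k)) + f (a ℕ.+ b))           ∎
  where open ≡-Reasoning

sumTo-reverse : ∀ M (f : ℕ → ℚ) → sumTo (suc M) (λ k → f (M ∸ k)) ≡ sumTo (suc M) f
sumTo-reverse zero f = refl
sumTo-reverse (suc M) f = begin
  sumTo (suc (suc M)) (λ k → f (suc M ∸ k))              ≡⟨ sumTo-head (suc M) (λ k → f (suc M ∸ k)) ⟩
  f (suc M) + sumTo (suc M) (λ k → f (M ∸ k))            ≡⟨ cong (f (suc M) +_) (sumTo-reverse M f) ⟩
  f (suc M) + sumTo (suc M) f                            ≡⟨ +-comm (f (suc M)) _ ⟩
  sumTo (suc (suc M)) f                                  ∎
  where open ≡-Reasoning

-- Normalised Pochhammer symbols and their binomial identities.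

-- bin x k = (x)_k / k!
bin : ℚ → ℕ → ℚ
bin x zero = 1ℚ
bin x (suc k) = bin x k * ((x + ℕ→ℚ k) * recip (suc k))

poch-1-≢0 : ∀ k → poch 1ℚ k ≢ 0ℚ
poch-1-≢0 zero ()
poch-1-≢0 (suc k) = *-≢0 (poch-1-≢0 k) λ eq → ℕ→ℚ-≢0 k (trans (ℕ→ℚ-suc k) eq)

bin-poch : ∀ x k → bin x k * poch 1ℚ k ≡ poch x k
bin-poch x zero = refl
bin-poch x (suc k) = begin
  b * ((x + a) * i) * (f * (1ℚ + a))    ≡⟨ regroup b x a i f ⟩
  b * f * (x + a) * ((1ℚ + a) * i)      ≡⟨ cong₂ (λ s t → s * (x + a) * t) (bin-poch x k) (trans (cong (_* i) (sym (ℕ→ℚ-suc k))) (recip-inverse k)) ⟩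
  poch x k * (x + a) * 1ℚ               ≡⟨ *-identityʳ _ ⟩
  poch x k * (x + a)                    ∎
  where
  open ≡-Reasoning
  a = ℕ→ℚ k
  b = bin x k
  i = recip (suc k)
  f = poch 1ℚ k
  regroup : ∀ b x a i f → b * ((x + a) * i) * (f * (1ℚ + a)) ≡ b * f * (x + a) * ((1ℚ + a) * i)
  regroup = solve-∀ ℚ-ring

-- Brings the summand of the theorem into the form of a single n-th power.
poch-quotient : ∀ x n k → (poch x k ^ n) ÷ (poch (ℕ→ℚ 1) k ^ n) ≡ bin x k ^ n
poch-quotient x n k = ÷-unique (^-≢0 n (poch-1-≢0 k))
  (trans (sym (^-distrib-* (bin x k) (poch 1ℚ k) n)) (cong (_^ n) (bin-poch x k)))

bin-suc : ∀ x k → bin x (suc k) * ℕ→ℚ (suc k) ≡ bin x k * (x + ℕ→ℚ k)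
bin-suc x k = trans (regroup (bin x k) (x + ℕ→ℚ k) (recip (suc k)) (ℕ→ℚ (suc k)))
  (trans (cong (bin x k * (x + ℕ→ℚ k) *_) (recip-inverse k)) (*-identityʳ _))
  where
  regroup : ∀ b y i s → b * (y * i) * s ≡ b * y * (s * i)
  regroup = solve-∀ ℚ-ring

-- Peels off the first factor of the Pochhammer symbol, where the definition peels off the last one.
bin-shift : ∀ x k → bin x (suc k) ≡ x * recip (suc k) * bin (1ℚ + x) k
bin-shift x zero = lemma x (recip 1)
  where
  lemma : ∀ x i → 1ℚ * ((x + 0ℚ) * i) ≡ x * i * 1ℚ
  lemma = solve-∀ ℚ-ring
bin-shift x (suc k) = begin
  bin x (suc k) * ((x + ℕ→ℚ (suc k)) * j)                      ≡⟨ cong₂ (λ b s → b * ((x + s) * j)) (bin-shift x k) (ℕ→ℚ-suc k) ⟩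
  x * i * bin (1ℚ + x) k * ((x + (1ℚ + ℕ→ℚ k)) * j)            ≡⟨ lemma x i (bin (1ℚ + x) k) (ℕ→ℚ k) j ⟩
  x * j * (bin (1ℚ + x) k * ((1ℚ + x + ℕ→ℚ k) * i))            ∎
  where
  open ≡-Reasoning
  i = recip (suc k)
  j = recip (suc (suc k))
  lemma : ∀ x i b k j → x * i * b * ((x + (1ℚ + k)) * j) ≡ x * j * (b * ((1ℚ + x + k) * i))
  lemma = solve-∀ ℚ-ring

bin-shift-* : ∀ x k → x * bin (1ℚ + x) k ≡ bin x k * (x + ℕ→ℚ k)
bin-shift-* x k = begin
  x * B                               ≡⟨ *-identityʳ (x * B) ⟨
  x * B * 1ℚ                          ≡⟨ cong (x * B *_) (recip-inverse k) ⟨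
  x * B * (s * i)                     ≡⟨ regroup x B s i ⟩
  x * i * B * s                       ≡⟨ cong (_* s) (bin-shift x k) ⟨
  bin x (suc k) * s                   ≡⟨ bin-suc x k ⟩
  bin x k * (x + ℕ→ℚ k)               ∎
  where
  open ≡-Reasoning
  B = bin (1ℚ + x) k
  s = ℕ→ℚ (suc k)
  i = recip (suc k)
  regroup : ∀ x B s i → x * B * (s * i) ≡ x * i * B * s
  regroup = solve-∀ ℚ-ring

bin-1 : ∀ k → bin 1ℚ k ≡ 1ℚ
bin-1 zero = refl
bin-1 (suc k) = trans (cong₂ (λ b s → b * (s * recip (suc k))) (bin-1 k) (sym (ℕ→ℚ-suc k)))
  (trans (*-identityˡ _) (recip-inverse k))

-- Both sides are the binomial coefficient C(m+k, k). The right side shows that (q)_k/k! with q = m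
-- + 1 is a polynomial in k of degree m.
bin-sym : ∀ m k → bin (ℕ→ℚ (suc m)) k ≡ bin (ℕ→ℚ (suc k)) m
bin-sym m zero = sym (bin-1 m)
bin-sym m (suc k) = begin
  bin (ℕ→ℚ (suc m)) k * ((ℕ→ℚ (suc m) + ℕ→ℚ k) * i)        ≡⟨ cong₂ (λ b s → b * (s * i)) (bin-sym m k) swap ⟩
  bin x m * ((x + ℕ→ℚ m) * i)                               ≡⟨ *-assoc (bin x m) (x + ℕ→ℚ m) i ⟨
  bin x m * (x + ℕ→ℚ m) * i                                 ≡⟨ cong (_* i) (bin-shift-* x m) ⟨
  x * bin (1ℚ + x) m * i                                    ≡⟨ regroup x (bin (1ℚ + x) m) i ⟩
  x * i * bin (1ℚ + x) m                                    ≡⟨ cong (_* bin (1ℚ + x) m) (recip-inverse k) ⟩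
  1ℚ * bin (1ℚ + x) m                                       ≡⟨ *-identityˡ _ ⟩
  bin (1ℚ + x) m                                            ≡⟨ cong (λ y → bin y m) (ℕ→ℚ-suc (suc k)) ⟨
  bin (ℕ→ℚ (suc (suc k))) m                                 ∎
  where
  open ≡-Reasoning
  x = ℕ→ℚ (suc k)
  i = recip (suc k)
  regroup : ∀ x B i → x * B * i ≡ x * i * B
  regroup = solve-∀ ℚ-ring
  swap : ℕ→ℚ (suc m) + ℕ→ℚ k ≡ x + ℕ→ℚ m
  swap = trans (sym (ℕ→ℚ-+ (suc m) k)) (trans (cong (λ i → ℕ→ℚ (suc i)) (ℕ.+-comm m k)) (ℕ→ℚ-+ (suc k) m))

-- For x = -N the value `bin x k` is (-1)^k C(N, k), and this becomes Pascal's rule; it drives the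
-- induction for finite differences.
bin-pascal : ∀ x k → bin (x - 1ℚ) (suc k) ≡ bin x (suc k) - bin x k
bin-pascal x zero = lemma x
  where
  lemma : ∀ x → 1ℚ * ((x - 1ℚ + 0ℚ) * 1ℚ) ≡ 1ℚ * ((x + 0ℚ) * 1ℚ) - 1ℚ
  lemma = solve-∀ ℚ-ring
bin-pascal x (suc k) = begin
  bin (x - 1ℚ) (suc k) * ((x - 1ℚ + t) * j)          ≡⟨ cong₂ (λ b t → b * ((x - 1ℚ + t) * j)) (bin-pascal x k) (ℕ→ℚ-suc k) ⟩
  (B - b) * ((x - 1ℚ + (1ℚ + s)) * j)                ≡⟨ expand B b x s j ⟩
  B * (x + s) * j - b * (x + s) * j                  ≡⟨ cong (λ c → B * (x + s) * j - c * j) (sym (bin-suc x k)) ⟩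
  B * (x + s) * j - B * t * j                        ≡⟨ cong (λ t → B * (x + s) * j - B * t * j) (ℕ→ℚ-suc k) ⟩
  B * (x + s) * j - B * (1ℚ + s) * j                 ≡⟨ collect B x s j ⟩
  B * ((x + (1ℚ + s)) * j) - B * ((1ℚ + (1ℚ + s)) * j)  ≡⟨ cong₂ (λ t u → B * ((x + t) * j) - B * (u * j)) (sym (ℕ→ℚ-suc k)) (sym (trans (ℕ→ℚ-suc (suc k)) (cong (λ r → 1ℚ + r) (ℕ→ℚ-suc k)))) ⟩
  B * ((x + t) * j) - B * (ℕ→ℚ (suc (suc k)) * j)    ≡⟨ cong (λ c → B * ((x + t) * j) - B * c) (recip-inverse (suc k)) ⟩
  B * ((x + t) * j) - B * 1ℚ                         ≡⟨ cong (λ c → B * ((x + t) * j) - c) (*-identityʳ B) ⟩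
  B * ((x + t) * j) - B                              ∎
  where
  open ≡-Reasoning
  B = bin x (suc k)
  b = bin x k
  s = ℕ→ℚ k
  t = ℕ→ℚ (suc k)
  j = recip (suc (suc k))
  expand : ∀ B b x s j → (B - b) * ((x - 1ℚ + (1ℚ + s)) * j) ≡ B * (x + s) * j - b * (x + s) * j
  expand = solve-∀ ℚ-ring
  collect : ∀ B x s j → B * (x + s) * j - B * (1ℚ + s) * j ≡ B * ((x + (1ℚ + s)) * j) - B * ((1ℚ + (1ℚ + s)) * j)
  collect = solve-∀ ℚ-ring

-- Finite differences and polynomial degree.

Δ : (ℕ → ℚ) → ℕ → ℚ
Δ f k = f (suc k) - f k

-- Deg d f: the d-th difference of f vanishes, i.e. f is polynomial of degree less than d.
data Deg : ℕ → (ℕ → ℚ) → Set where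
  vanishing : ∀ {f} → (∀ k → f k ≡ 0ℚ) → Deg zero f
  difference : ∀ {d f} → Deg d (Δ f) → Deg (suc d) f

Deg-cong : ∀ {d} {f g : ℕ → ℚ} → (∀ k → f k ≡ g k) → Deg d f → Deg d g
Deg-cong eq (vanishing f≡0) = vanishing λ k → trans (sym (eq k)) (f≡0 k)
Deg-cong eq (difference D) = difference (Deg-cong (λ k → cong₂ _-_ (eq (suc k)) (eq k)) D)

Deg-zero : ∀ d {f : ℕ → ℚ} → (∀ k → f k ≡ 0ℚ) → Deg d f
Deg-zero zero eq = vanishing eq
Deg-zero (suc d) eq = difference (Deg-zero d λ k → cong₂ _-_ (eq (suc k)) (eq k))

Deg-mono : ∀ {d e} {f : ℕ → ℚ} → d ≤ e → Deg d f → Deg e f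
Deg-mono {e = e} z≤n (vanishing f≡0) = Deg-zero e f≡0
Deg-mono (s≤s d≤e) (difference D) = difference (Deg-mono d≤e D)

Deg-shift : ∀ {d} {f : ℕ → ℚ} → Deg d f → Deg d (λ k → f (suc k))
Deg-shift (vanishing f≡0) = vanishing λ k → f≡0 (suc k)
Deg-shift (difference D) = difference (Deg-shift D)

Deg-+ : ∀ {d} {f g : ℕ → ℚ} → Deg d f → Deg d g → Deg d (λ k → f k + g k)
Deg-+ (vanishing f≡0) (vanishing g≡0) = vanishing λ k → cong₂ _+_ (f≡0 k) (g≡0 k)
Deg-+ {f = f} {g} (difference D) (difference E) =
  difference (Deg-cong (λ k → lemma (f (suc k)) (f k) (g (suc k)) (g k)) (Deg-+ D E))
  where
  lemma : ∀ a b c d → (a - b) + (c - d) ≡ a + c - (b + d)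
  lemma = solve-∀ ℚ-ring

Deg-const : ∀ c → Deg 1 (λ _ → c)
Deg-const c = difference (vanishing λ _ → +-inverseʳ c)

-- Discrete Leibniz rule: Δ(fg)(k) = Δf(k) g(k+1) + f(k) Δg(k), and each term has one factor of
-- lower degree. With `Deg (suc a)` read as degree at most a, degrees add.
Deg-* : ∀ a b {f g : ℕ → ℚ} → Deg (suc a) f → Deg (suc b) g → Deg (suc (a ℕ.+ b)) (λ k → f k * g k)
Deg-* a b {f} {g} Df@(difference DΔf) Dg@(difference DΔg) =
  difference (Deg-cong (λ k → leibniz (f (suc k)) (f k) (g (suc k)) (g k)) (Deg-+ (left a DΔf) (right b DΔg)))
  where
  leibniz : ∀ f′ f g′ g → (f′ - f) * g′ + f * (g′ - g) ≡ f′ * g′ - f * g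
  leibniz = solve-∀ ℚ-ring
  left : ∀ a → Deg a (Δ f) → Deg (a ℕ.+ b) (λ k → Δ f k * g (suc k))
  left zero (vanishing eq) = Deg-zero b λ k → trans (cong (_* g (suc k)) (eq k)) (*-zeroˡ (g (suc k)))
  left (suc a) D = Deg-* a b D (Deg-shift Dg)
  right : ∀ b → Deg b (Δ g) → Deg (a ℕ.+ b) (λ k → f k * Δ g k)
  right zero (vanishing eq) = Deg-zero (a ℕ.+ 0) λ k → trans (cong (f k *_) (eq k)) (*-zeroʳ (f k))
  right (suc b) D = subst (λ d → Deg d (λ k → f k * Δ g k)) (sym (ℕ.+-suc a b)) (Deg-* a b Df D)

Deg-^ : ∀ a n {f : ℕ → ℚ} → Deg (suc a) f → Deg (suc (n ℕ.* a)) (λ k → f k ^ n)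
Deg-^ a zero Df = Deg-const 1ℚ
Deg-^ a (suc n) Df = Deg-* a (n ℕ.* a) Df (Deg-^ a n Df)

Deg-linear : ∀ c → Deg 2 (λ k → ℕ→ℚ (suc k) + c)
Deg-linear c = difference (Deg-cong (λ k → sym (step k)) (Deg-const 1ℚ))
  where
  lemma : ∀ s c → 1ℚ + s + c - (s + c) ≡ 1ℚ
  lemma = solve-∀ ℚ-ring
  step : ∀ k → ℕ→ℚ (suc (suc k)) + c - (ℕ→ℚ (suc k) + c) ≡ 1ℚ
  step k = trans (cong (λ s → s + c - (ℕ→ℚ (suc k) + c)) (ℕ→ℚ-suc (suc k))) (lemma (ℕ→ℚ (suc k)) c)

Deg-bin : ∀ m → Deg (suc m) (λ k → bin (ℕ→ℚ (suc k)) m)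
Deg-bin zero = Deg-const 1ℚ
Deg-bin (suc m) = subst (λ d → Deg (suc d) (λ k → bin (ℕ→ℚ (suc k)) (suc m))) (ℕ.+-comm m 1)
  (Deg-* m 1 (Deg-bin m) (Deg-* 1 0 (Deg-linear (ℕ→ℚ m)) (Deg-const (recip (suc m)))))

-- Up to sign, the left-hand side is the N-th finite difference of f at 0.
alternating-sum : ∀ N (f : ℕ → ℚ) → Deg N f → sumTo (suc N) (λ k → bin (- ℕ→ℚ N) k * f k) ≡ 0ℚ
alternating-sum zero f (vanishing f≡0) = trans (+-identityˡ _) (trans (*-identityˡ _) (f≡0 0))
alternating-sum (suc N) f (difference Df) = begin
  sumTo (suc (suc N)) (λ k → bin (- ℕ→ℚ (suc N)) k * f k)
    ≡⟨ sumTo-head (suc N) (λ k → bin (- ℕ→ℚ (suc N)) k * f k) ⟩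
  1ℚ * f 0 + sumTo (suc N) (λ k → bin (- ℕ→ℚ (suc N)) (suc k) * f (suc k))
    -- Pascal's rule turns each term into B f(k+1) - b Δf(k) - b f(k). The outer parts cancel up to
    -- an end term, and the middle one falls to the induction hypothesis for `Δ f`.
    ≡⟨ cong (1ℚ * f 0 +_) (sumTo-cong (suc N) λ k _ → trans (cong (_* f (suc k)) (pascal k)) (expand (bin x (suc k)) (bin x k) (f (suc k)) (f k))) ⟩
  1ℚ * f 0 + sumTo (suc N) (λ k → bin x (suc k) * f (suc k) + (- 1ℚ * (bin x k * Δ f k) + - 1ℚ * (bin x k * f k)))
    ≡⟨ cong (1ℚ * f 0 +_) (trans (sumTo-+ (suc N) _ _) (cong (tail +_) (trans (sumTo-+ (suc N) _ _) (cong₂ _+_ (sumTo-*ˡ (suc N) (- 1ℚ) _) (sumTo-*ˡ (suc N) (- 1ℚ) _))))) ⟩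
  1ℚ * f 0 + (tail + (- 1ℚ * sumTo (suc N) (λ k → bin x k * Δ f k) + - 1ℚ * whole))
    ≡⟨ cong (λ s → 1ℚ * f 0 + (tail + (- 1ℚ * s + - 1ℚ * whole))) (alternating-sum N (Δ f) Df) ⟩
  1ℚ * f 0 + (tail + (- 1ℚ * 0ℚ + - 1ℚ * whole))
    ≡⟨ regroup (1ℚ * f 0) tail whole ⟩
  (1ℚ * f 0 + tail) - whole
    ≡⟨ cong (_- whole) (sumTo-head (suc N) (λ k → bin x k * f k)) ⟨
  whole + bin x (suc N) * f (suc N) - whole
    -- The end term contains the factor x + N = 0.
    ≡⟨ cong (λ s → whole + s * f (suc N) - whole) vanish ⟩
  whole + 0ℚ * f (suc N) - whole
    ≡⟨ cancel whole (f (suc N)) ⟩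
  0ℚ ∎
  where
  open ≡-Reasoning
  x = - ℕ→ℚ N
  tail = sumTo (suc N) (λ k → bin x (suc k) * f (suc k))
  whole = sumTo (suc N) (λ k → bin x k * f k)
  neg-suc : ∀ a → - (1ℚ + a) ≡ - a - 1ℚ
  neg-suc = solve-∀ ℚ-ring
  pascal : ∀ k → bin (- ℕ→ℚ (suc N)) (suc k) ≡ bin x (suc k) - bin x k
  pascal k = trans (cong (λ y → bin y (suc k)) (trans (cong -_ (ℕ→ℚ-suc N)) (neg-suc (ℕ→ℚ N)))) (bin-pascal x k)
  expand : ∀ B b g f → (B - b) * g ≡ B * g + (- 1ℚ * (b * (g - f)) + - 1ℚ * (b * f))
  expand = solve-∀ ℚ-ring
  regroup : ∀ a t w → a + (t + (- 1ℚ * 0ℚ + - 1ℚ * w)) ≡ (a + t) - w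
  regroup = solve-∀ ℚ-ring
  cancel : ∀ w g → w + 0ℚ * g - w ≡ 0ℚ
  cancel = solve-∀ ℚ-ring
  zero-factor : ∀ b a i → b * ((- a + a) * i) ≡ 0ℚ
  zero-factor = solve-∀ ℚ-ring
  vanish : bin x (suc N) ≡ 0ℚ
  vanish = zero-factor (bin x N) (ℕ→ℚ N) (recip (suc N))

-- Clearing the denominators of a sum of inverse squares.

recip² : ℕ → ℚ
recip² a = recip a * recip a

-- binRecip² m k is the polynomial (in k) obtained from bin (k+1) m ² · Σ_{j<m} 1/(k+1+j)² by cancelling the denominators.
binRecip² : ℕ → ℕ → ℚ
binRecip² zero k = 0ℚ
binRecip² (suc m) k = binRecip² m k * (y * y) + z * z
  where
  y = (ℕ→ℚ (suc k) + ℕ→ℚ m) * recip (suc m)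
  z = bin (ℕ→ℚ (suc k)) m * recip (suc m)

-- Passing from m to m + 1 multiplies the squared product by x²/(m+1)² with x = k + 1 + m. This
-- rescales the old terms and cancels the new denominator x².
binRecip²-spec : ∀ m k → bin (ℕ→ℚ (suc k)) m * bin (ℕ→ℚ (suc k)) m * sumTo m (λ j → recip² (suc k ℕ.+ j)) ≡ binRecip² m k
binRecip²-spec zero k = *-zeroʳ (1ℚ * 1ℚ)
binRecip²-spec (suc m) k = begin
  b * (x * i) * (b * (x * i)) * (r + ρ * ρ)
    ≡⟨ expand b x i r ρ ⟩
  b * b * r * (x * i * (x * i)) + b * i * (b * i) * (x * ρ * (x * ρ))
    ≡⟨ cong₂ (λ s t → s * (x * i * (x * i)) + b * i * (b * i) * (t * t)) (binRecip²-spec m k) xρ≡1 ⟩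
  binRecip² m k * (x * i * (x * i)) + b * i * (b * i) * (1ℚ * 1ℚ)
    ≡⟨ cong (λ s → binRecip² m k * (x * i * (x * i)) + s) (*-identityʳ (b * i * (b * i))) ⟩
  binRecip² m k * (x * i * (x * i)) + b * i * (b * i)
    ∎
  where
  open ≡-Reasoning
  b = bin (ℕ→ℚ (suc k)) m
  x = ℕ→ℚ (suc k) + ℕ→ℚ m
  i = recip (suc m)
  ρ = recip (suc k ℕ.+ m)
  r = sumTo m (λ j → recip² (suc k ℕ.+ j))
  xρ≡1 : x * ρ ≡ 1ℚ
  xρ≡1 = trans (cong (_* ρ) (sym (ℕ→ℚ-+ (suc k) m))) (recip-inverse (k ℕ.+ m))
  expand : ∀ b x i r ρ → b * (x * i) * (b * (x * i)) * (r + ρ * ρ)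
                       ≡ b * b * r * (x * i * (x * i)) + b * i * (b * i) * (x * ρ * (x * ρ))
  expand = solve-∀ ℚ-ring

-- The bound 2m is the degree of the square that absorbs the denominators, so trading two factors of
-- degree m for `binRecip² m` does not raise the degree bound of a product.
Deg-binRecip² : ∀ m → Deg (suc (m ℕ.+ m)) (binRecip² m)
Deg-binRecip² zero = Deg-const 0ℚ
Deg-binRecip² (suc m) = Deg-+
  (Deg-mono (ℕ.≤-reflexive (cong suc deg₁)) (Deg-* (m ℕ.+ m) 2 (Deg-binRecip² m) (Deg-* 1 1 Dy Dy)))
  (Deg-mono deg₂ (Deg-* (m ℕ.+ 0) (m ℕ.+ 0) Dz Dz))
  where
  Dy = Deg-* 1 0 (Deg-linear (ℕ→ℚ m)) (Deg-const (recip (suc m)))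
  Dz = Deg-* m 0 (Deg-bin m) (Deg-const (recip (suc m)))
  deg₁ : m ℕ.+ m ℕ.+ 2 ≡ suc m ℕ.+ suc m
  deg₁ = trans (ℕ.+-assoc m m 2) (trans (cong (m ℕ.+_) (ℕ.+-comm m 2)) (ℕ.+-suc m (suc m)))
  m+0≤ : m ℕ.+ 0 ≤ suc m
  m+0≤ = ℕ.≤-trans (ℕ.≤-reflexive (ℕ.+-identityʳ m)) (ℕ.n≤1+n m)
  deg₂ : suc (m ℕ.+ 0 ℕ.+ (m ℕ.+ 0)) ≤ suc (suc m ℕ.+ suc m)
  deg₂ = s≤s (ℕ.+-mono-≤ m+0≤ m+0≤)

-- Rationals that are integral at p.

*-denominator : ∀ x → x * ℕ→ℚ (↧ₙ x) ≡ ℤ→ℚ (↥ x)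
*-denominator x@(mkℚ i d _) = toℚᵘ-injective (begin
  toℚᵘ (x * ℕ→ℚ (suc d))                   ≈⟨ toℚᵘ-homo-* x (ℕ→ℚ (suc d)) ⟩
  toℚᵘ x ℚᵘ.* toℚᵘ (ℕ→ℚ (suc d))           ≈⟨ ℚᵘ.*-congˡ {toℚᵘ x} (toℚᵘ-fromℚᵘ (mkℚᵘ (ℤ.+ suc d) 0)) ⟩
  toℚᵘ x ℚᵘ.* mkℚᵘ (ℤ.+ suc d) 0           ≈⟨ *≡* (trans (ℤ.*-identityʳ _) (cong (λ e → i ℤ.* ℤ.+ e) (sym (ℕ.*-identityʳ (suc d))))) ⟩
  mkℚᵘ i 0                                 ≈⟨ toℚᵘ-fromℚᵘ (mkℚᵘ i 0) ⟨
  toℚᵘ (ℤ→ℚ i)                             ∎)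
  where open import Relation.Binary.Reasoning.Setoid ℚᵘ.≃-setoid

coprime-↧-↥ : ∀ x → Coprime (↧ₙ x) ℤ.∣ ↥ x ∣
coprime-↧-↥ (mkℚ i d i⊥d) = Coprime.sym (Coprime.recompute i⊥d)

-- x is p-integral, witnessed by a fraction num / den that need not be in lowest terms.
record Integral (p : ℕ) (x : ℚ) : Set where
  constructor fraction
  field
    den : ℕ
    num : ℤ
    p∤den : ¬ p ∣ den
    clear : x * ℕ→ℚ den ≡ ℤ→ℚ num

-- The reduced denominator divides every denominator d of x: from `↥ x` · d = a · `↧ₙ x` and
-- coprimality of `↧ₙ x` with `↥ x`.
integral⇒p∤↧ : ∀ {p x} → Integral p x → ¬ p ∣ ↧ₙ x
integral⇒p∤↧ {p} {x} (fraction d a p∤d xd≡a) p∣↧x = p∤d (∣-trans p∣↧x ↧x∣d)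
  where
  open ≡-Reasoning
  swap : ∀ x d e → x * d * e ≡ x * e * d
  swap = solve-∀ ℚ-ring
  cross : ↥ x ℤ.* ℤ.+ d ≡ a ℤ.* ℤ.+ (↧ₙ x)
  cross = ℤ→ℚ-injective (begin
    ℤ→ℚ (↥ x ℤ.* ℤ.+ d)            ≡⟨ ℤ→ℚ-* (↥ x) (ℤ.+ d) ⟩
    ℤ→ℚ (↥ x) * ℕ→ℚ d              ≡⟨ cong (_* ℕ→ℚ d) (*-denominator x) ⟨
    x * ℕ→ℚ (↧ₙ x) * ℕ→ℚ d         ≡⟨ swap x (ℕ→ℚ (↧ₙ x)) (ℕ→ℚ d) ⟩
    x * ℕ→ℚ d * ℕ→ℚ (↧ₙ x)         ≡⟨ cong (_* ℕ→ℚ (↧ₙ x)) xd≡a ⟩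
    ℤ→ℚ a * ℕ→ℚ (↧ₙ x)             ≡⟨ ℤ→ℚ-* a (ℤ.+ (↧ₙ x)) ⟨
    ℤ→ℚ (a ℤ.* ℤ.+ (↧ₙ x))         ∎)
  ∣cross∣ : ℤ.∣ ↥ x ∣ ℕ.* d ≡ ℤ.∣ a ∣ ℕ.* ↧ₙ x
  ∣cross∣ = trans (sym (ℤ.abs-* (↥ x) (ℤ.+ d))) (trans (cong ℤ.∣_∣ cross) (ℤ.abs-* a (ℤ.+ (↧ₙ x))))
  ↧x∣d : ↧ₙ x ∣ d
  ↧x∣d = coprime-divisor (coprime-↧-↥ x) (divides ℤ.∣ a ∣ ∣cross∣)

-- The local ring at p.

module Localisation (p : ℕ) (p-prime : Prime p) where

  Z : ℚ → Set
  Z = Integral p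

  π : ℚ
  π = ℕ→ℚ p

  1<p : 1 < p
  1<p = ℕ.nonTrivial⇒n>1 p {{prime⇒nonTrivial p-prime}}

  p∤1 : ¬ p ∣ 1
  p∤1 p∣1 = ℕ.<⇒≢ 1<p (sym (∣1⇒≡1 p∣1))

  p∤* : ∀ {a b} → ¬ p ∣ a → ¬ p ∣ b → ¬ p ∣ a ℕ.* b
  p∤* {a} {b} p∤a p∤b p∣ab with euclidsLemma a b p-prime p∣ab
  ... | inj₁ p∣a = p∤a p∣a
  ... | inj₂ p∣b = p∤b p∣b

  Z-ℤ : ∀ i → Z (ℤ→ℚ i)
  Z-ℤ i = fraction 1 i p∤1 (*-identityʳ (ℤ→ℚ i))

  Z-ℕ : ∀ a → Z (ℕ→ℚ a)
  Z-ℕ a = Z-ℤ (ℤ.+ a)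

  Z-0 : Z 0ℚ
  Z-0 = Z-ℕ 0

  Z-1 : Z 1ℚ
  Z-1 = Z-ℕ 1

  Z-+ : ∀ {x y} → Z x → Z y → Z (x + y)
  Z-+ {x} {y} (fraction d a p∤d xd≡a) (fraction e b p∤e ye≡b) =
    fraction (d ℕ.* e) (a ℤ.* ℤ.+ e ℤ.+ b ℤ.* ℤ.+ d) (p∤* p∤d p∤e) (begin
      (x + y) * ℕ→ℚ (d ℕ.* e)                                  ≡⟨ cong ((x + y) *_) (ℕ→ℚ-* d e) ⟩
      (x + y) * (ℕ→ℚ d * ℕ→ℚ e)                                ≡⟨ expand x y (ℕ→ℚ d) (ℕ→ℚ e) ⟩
      x * ℕ→ℚ d * ℕ→ℚ e + y * ℕ→ℚ e * ℕ→ℚ d                    ≡⟨ cong₂ (λ s t → s * ℕ→ℚ e + t * ℕ→ℚ d) xd≡a ye≡b ⟩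
      ℤ→ℚ a * ℕ→ℚ e + ℤ→ℚ b * ℕ→ℚ d                            ≡⟨ cong₂ _+_ (ℤ→ℚ-* a (ℤ.+ e)) (ℤ→ℚ-* b (ℤ.+ d)) ⟨
      ℤ→ℚ (a ℤ.* ℤ.+ e) + ℤ→ℚ (b ℤ.* ℤ.+ d)                    ≡⟨ ℤ→ℚ-+ (a ℤ.* ℤ.+ e) (b ℤ.* ℤ.+ d) ⟨
      ℤ→ℚ (a ℤ.* ℤ.+ e ℤ.+ b ℤ.* ℤ.+ d)                        ∎)
    where
    open ≡-Reasoning
    expand : ∀ x y d e → (x + y) * (d * e) ≡ x * d * e + y * e * d
    expand = solve-∀ ℚ-ring

  Z-* : ∀ {x y} → Z x → Z y → Z (x * y)
  Z-* {x} {y} (fraction d a p∤d xd≡a) (fraction e b p∤e ye≡b) =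
    fraction (d ℕ.* e) (a ℤ.* b) (p∤* p∤d p∤e) (begin
      x * y * ℕ→ℚ (d ℕ.* e)                ≡⟨ cong (x * y *_) (ℕ→ℚ-* d e) ⟩
      x * y * (ℕ→ℚ d * ℕ→ℚ e)              ≡⟨ regroup x y (ℕ→ℚ d) (ℕ→ℚ e) ⟩
      x * ℕ→ℚ d * (y * ℕ→ℚ e)              ≡⟨ cong₂ _*_ xd≡a ye≡b ⟩
      ℤ→ℚ a * ℤ→ℚ b                        ≡⟨ ℤ→ℚ-* a b ⟨
      ℤ→ℚ (a ℤ.* b)                        ∎)
    where
    open ≡-Reasoning
    regroup : ∀ x y d e → x * y * (d * e) ≡ x * d * (y * e)
    regroup = solve-∀ ℚ-ring

  Z-neg : ∀ {x} → Z x → Z (- x)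
  Z-neg {x} Zx = subst Z (neg x) (Z-* (Z-ℤ (ℤ.- ℤ.+ 1)) Zx)
    where
    neg : ∀ x → - 1ℚ * x ≡ - x
    neg = solve-∀ ℚ-ring

  Z-minus : ∀ {x y} → Z x → Z y → Z (x - y)
  Z-minus Zx Zy = Z-+ Zx (Z-neg Zy)

  Z-^ : ∀ {x} m → Z x → Z (x ^ m)
  Z-^ zero Zx = Z-1
  Z-^ (suc m) Zx = Z-* Zx (Z-^ m Zx)

  Z-recip : ∀ {a} → suc a < p → Z (recip (suc a))
  Z-recip {a} a<p = fraction (suc a) (ℤ.+ 1) (λ p∣a → ℕ.<⇒≱ a<p (∣⇒≤ p∣a))
    (trans (*-comm (recip (suc a)) (ℕ→ℚ (suc a))) (recip-inverse a))

  Z-sum : ∀ N {f : ℕ → ℚ} → (∀ k → k < N → Z (f k)) → Z (sumTo N f)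
  Z-sum zero Zf = Z-0
  Z-sum (suc N) Zf = Z-+ (Z-sum N λ k k<N → Zf k (ℕ.m<n⇒m<1+n k<N)) (Zf N ℕ.≤-refl)

  Z-bin : ∀ {x} k → k < p → Z x → Z (bin x k)
  Z-bin zero k<p Zx = Z-1
  Z-bin (suc k) k<p Zx = Z-* (Z-bin k (ℕ.<-trans (ℕ.n<1+n k) k<p) Zx) (Z-* (Z-+ Zx (Z-ℕ k)) (Z-recip k<p))

  -- Congruences modulo powers of p.

  infix 4 _≈[_]_
  record _≈[_]_ (a : ℚ) (m : ℕ) (b : ℚ) : Set where
    constructor congruent
    field
      quotient : ℚ
      integral : Z quotient
      equation : a - b ≡ π ^ m * quotient

  -- Only here is the quotient put in lowest terms; all calculations allow any fraction with
  -- denominator prime to p.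
  ≈⇒≡mod : ∀ {a m b} → a ≈[ m ] b → a ≡ b [mod p ^ m ]
  ≈⇒≡mod (congruent c Zc eq) = c , eq , integral⇒p∤↧ Zc

  ≈-reflexive : ∀ {m a b} → a ≡ b → a ≈[ m ] b
  ≈-reflexive {m} {a} refl = congruent 0ℚ Z-0 (trans (+-inverseʳ a) (sym (*-zeroʳ (π ^ m))))

  ≈-refl : ∀ {m a} → a ≈[ m ] a
  ≈-refl = ≈-reflexive refl

  ≈-sym : ∀ {m a b} → a ≈[ m ] b → b ≈[ m ] a
  ≈-sym {m} {a} {b} (congruent c Zc eq) =
    congruent (- c) (Z-neg Zc) (trans (flip a b) (trans (cong -_ eq) (neg-distribʳ-* (π ^ m) c)))
    where
    flip : ∀ a b → b - a ≡ - (a - b)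
    flip = solve-∀ ℚ-ring

  ≈-trans : ∀ {m a b c} → a ≈[ m ] b → b ≈[ m ] c → a ≈[ m ] c
  ≈-trans {m} {a} {b} {c} (congruent s Zs eq) (congruent t Zt eq′) =
    congruent (s + t) (Z-+ Zs Zt) (trans (telescope a b c) (trans (cong₂ _+_ eq eq′) (sym (*-distribˡ-+ (π ^ m) s t))))
    where
    telescope : ∀ a b c → a - c ≡ (a - b) + (b - c)
    telescope = solve-∀ ℚ-ring

  ≈-setoid : ℕ → Setoid _ _
  ≈-setoid m = record
    { Carrier = ℚ
    ; _≈_ = _≈[ m ]_
    ; isEquivalence = record { refl = ≈-refl ; sym = ≈-sym ; trans = ≈-trans }
    }

  ≈-+ : ∀ {m a b c d} → a ≈[ m ] b → c ≈[ m ] d → a + c ≈[ m ] b + d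
  ≈-+ {m} {a} {b} {c} {d} (congruent s Zs eq) (congruent t Zt eq′) =
    congruent (s + t) (Z-+ Zs Zt) (trans (split a b c d) (trans (cong₂ _+_ eq eq′) (sym (*-distribˡ-+ (π ^ m) s t))))
    where
    split : ∀ a b c d → a + c - (b + d) ≡ (a - b) + (c - d)
    split = solve-∀ ℚ-ring

  ≈-+ˡ : ∀ {m b c} a → b ≈[ m ] c → a + b ≈[ m ] a + c
  ≈-+ˡ a = ≈-+ (≈-refl {a = a})

  ≈-*ˡ : ∀ {m a b c} → Z c → a ≈[ m ] b → c * a ≈[ m ] c * b
  ≈-*ˡ {m} {a} {b} {c} Zc (congruent s Zs eq) =
    congruent (c * s) (Z-* Zc Zs) (trans (factor a b c) (trans (cong (c *_) eq) (regroup c (π ^ m) s)))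
    where
    factor : ∀ a b c → c * a - c * b ≡ c * (a - b)
    factor = solve-∀ ℚ-ring
    regroup : ∀ c q s → c * (q * s) ≡ q * (c * s)
    regroup = solve-∀ ℚ-ring

  ≈-*ʳ : ∀ {m a b c} → Z c → a ≈[ m ] b → a * c ≈[ m ] b * c
  ≈-*ʳ {m} {a} {b} {c} Zc a≈b =
    subst₂ (_≈[ m ]_) (*-comm c a) (*-comm c b) (≈-*ˡ Zc a≈b)

  ≈-* : ∀ {m a b c d} → Z a → Z d → a ≈[ m ] b → c ≈[ m ] d → a * c ≈[ m ] b * d
  ≈-* Za Zd a≈b c≈d = ≈-trans (≈-*ˡ Za c≈d) (≈-*ʳ Zd a≈b)

  ≈-^ : ∀ {m a b} j → Z a → Z b → a ≈[ m ] b → a ^ j ≈[ m ] b ^ j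
  ≈-^ zero Za Zb a≈b = ≈-refl
  ≈-^ (suc j) Za Zb a≈b = ≈-* Za (Z-^ j Zb) a≈b (≈-^ j Za Zb a≈b)

  ≈-sum : ∀ {m} N {f g : ℕ → ℚ} → (∀ k → k < N → f k ≈[ m ] g k) → sumTo N f ≈[ m ] sumTo N g
  ≈-sum zero eq = ≈-refl
  ≈-sum (suc N) eq = ≈-+ (≈-sum N λ k k<N → eq k (ℕ.m<n⇒m<1+n k<N)) (eq N ℕ.≤-refl)

  ≈-sum-0 : ∀ {m} N {f : ℕ → ℚ} → (∀ k → k < N → f k ≈[ m ] 0ℚ) → sumTo N f ≈[ m ] 0ℚ
  ≈-sum-0 zero eq = ≈-refl
  ≈-sum-0 (suc N) eq = ≈-+ (≈-sum-0 N λ k k<N → eq k (ℕ.m<n⇒m<1+n k<N)) (eq N ℕ.≤-refl)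

  ≈-bin : ∀ {m x y} k → k < p → Z x → Z y → x ≈[ m ] y → bin x k ≈[ m ] bin y k
  ≈-bin zero k<p Zx Zy x≈y = ≈-refl
  ≈-bin (suc k) k<p Zx Zy x≈y =
    ≈-* (Z-bin k k′<p Zx) (Z-* (Z-+ Zy (Z-ℕ k)) (Z-recip k<p)) (≈-bin k k′<p Zx Zy x≈y)
      (≈-*ʳ (Z-recip k<p) (≈-+ x≈y ≈-refl))
    where k′<p = ℕ.<-trans (ℕ.n<1+n k) k<p

  -- Correction terms carrying p² need to be known only mod p.
  p²-scale : ∀ {a b} → a ≈[ 1 ] b → π * π * a ≈[ 3 ] π * π * b
  p²-scale {a} {b} (congruent c Zc eq) =
    congruent c Zc (trans (factor π a b) (trans (cong (π * π *_) eq) (regroup π c)))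
    where
    factor : ∀ q a b → q * q * a - q * q * b ≡ q * q * (a - b)
    factor = solve-∀ ℚ-ring
    regroup : ∀ q c → q * q * (q * 1ℚ * c) ≡ q * (q * (q * 1ℚ)) * c
    regroup = solve-∀ ℚ-ring

  complement : ∀ {a b} → a ℕ.+ b ≡ p → ℕ→ℚ a ≈[ 1 ] - ℕ→ℚ b
  complement {a} {b} a+b≡p = congruent 1ℚ Z-1 (trans (flip (ℕ→ℚ a) (ℕ→ℚ b))
    (trans (sym (ℕ→ℚ-+ a b)) (trans (cong ℕ→ℚ a+b≡p) (unit π))))
    where
    flip : ∀ a b → a - - b ≡ a + b
    flip = solve-∀ ℚ-ring
    unit : ∀ q → q ≡ q * 1ℚ * 1ℚ
    unit = solve-∀ ℚ-ring

  Z-recip² : ∀ {a} → suc a < p → Z (recip² (suc a))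
  Z-recip² a<p = Z-* (Z-recip a<p) (Z-recip a<p)

  Z-binRecip² : ∀ m k → m < p → Z (binRecip² m k)
  Z-binRecip² zero k m<p = Z-0
  Z-binRecip² (suc m) k m<p = Z-+ (Z-* (Z-binRecip² m k m′<p) (Z-* Zy Zy)) (Z-* Zz Zz)
    where
    m′<p = ℕ.<-trans (ℕ.n<1+n m) m<p
    Zy = Z-* (Z-+ (Z-ℕ (suc k)) (Z-ℕ m)) (Z-recip m<p)
    Zz = Z-* (Z-bin m m′<p (Z-ℕ (suc k))) (Z-recip m<p)

  -- With i = 1/(a+1) and j = 1/(b+1), i² - j² = (i - j)(i + j), and i + j is the sum of the two
  -- denominators, namely p, times ij.
  recip²-complement : ∀ {a b} → suc a ℕ.+ suc b ≡ p → recip² (suc a) ≈[ 1 ] recip² (suc b)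
  recip²-complement {a} {b} a+b≡p = congruent ((i - j) * (i * j)) (Z-* (Z-minus Zi Zj) (Z-* Zi Zj)) (begin
    i * i - j * j                                         ≡⟨ factor i j ⟩
    (i - j) * (1ℚ * i + 1ℚ * j)                           ≡⟨ cong₂ (λ s t → (i - j) * (s * i + t * j)) (recip-inverse b) (recip-inverse a) ⟨
    (i - j) * (B * j * i + A * i * j)                     ≡⟨ collect i j A B ⟩
    (A + B) * 1ℚ * ((i - j) * (i * j))                    ≡⟨ cong (λ s → s * 1ℚ * ((i - j) * (i * j))) (trans (sym (ℕ→ℚ-+ (suc a) (suc b))) (cong ℕ→ℚ a+b≡p)) ⟩
    π * 1ℚ * ((i - j) * (i * j))                          ∎)
    where
    open ≡-Reasoning
    A = ℕ→ℚ (suc a)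
    B = ℕ→ℚ (suc b)
    i = recip (suc a)
    j = recip (suc b)
    Zi = Z-recip (ℕ.<-≤-trans (ℕ.m<m+n (suc a) (s≤s z≤n)) (ℕ.≤-reflexive a+b≡p))
    Zj = Z-recip (ℕ.<-≤-trans (ℕ.m<n+m (suc b) (s≤s z≤n)) (ℕ.≤-reflexive a+b≡p))
    factor : ∀ i j → i * i - j * j ≡ (i - j) * (1ℚ * i + 1ℚ * j)
    factor = solve-∀ ℚ-ring
    collect : ∀ i j A B → (i - j) * (B * j * i + A * i * j) ≡ (A + B) * 1ℚ * ((i - j) * (i * j))
    collect = solve-∀ ℚ-ring

  -- Polynomial sums and Pochhammer symbols modulo p.

  -- (-1)^k C(p-1,k) ≡ 1 (mod p) turns a full sum into an alternating one.
  polynomial-sum : ∀ {N} {f : ℕ → ℚ} → suc N ≡ p → (∀ k → Z (f k)) → Deg N f → sumTo p f ≈[ 1 ] 0ℚ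
  polynomial-sum {N} {f} refl Zf Df = ≈-trans
    (≈-sum (suc N) λ k k<p → ≈-trans (≈-reflexive (sym (*-identityˡ (f k)))) (≈-*ʳ (Zf k) (≈-sym (bin≈1 k k<p))))
    (≈-reflexive (alternating-sum N f Df))
    where
    bin≈1 : ∀ k → k < p → bin (- ℕ→ℚ N) k ≈[ 1 ] 1ℚ
    -- Since 1 + N = p, -N ≡ 1, and (1)_k/k! = 1.
    bin≈1 k k<p = ≈-trans (≈-bin k k<p (Z-neg (Z-ℕ N)) Z-1 (≈-sym (complement {1} {N} refl))) (≈-reflexive (bin-1 k))

  -- With A = a + 1 = p - j, the factors A, ..., A + j - 1 are ≡ -j, ..., -1, with product (-1)^j
  -- j!. Peeling off the first factor raises a and lowers j together, which keeps the sum equal to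
  -- p.
  bin-complement : ∀ j a → suc a ℕ.+ j ≡ p → bin (ℕ→ℚ (suc a)) j ≈[ 1 ] (- 1ℚ) ^ j
  bin-complement zero a a+j≡p = ≈-refl
  bin-complement (suc j) a a+j≡p = begin
    bin A (suc j)                                      ≡⟨ bin-shift A j ⟩
    A * i * bin (1ℚ + A) j                             ≡⟨ cong (λ x → A * i * bin x j) (ℕ→ℚ-suc (suc a)) ⟨
    A * i * bin (ℕ→ℚ (suc (suc a))) j                  ≈⟨ ≈-*ˡ (Z-* (Z-ℕ (suc a)) Zi) (bin-complement j (suc a) (trans (sym (ℕ.+-suc (suc a) j)) a+j≡p)) ⟩
    A * i * (- 1ℚ) ^ j                                 ≈⟨ ≈-*ʳ (Z-^ j (Z-neg Z-1)) (≈-*ʳ Zi (complement {suc a} {suc j} a+j≡p)) ⟩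
    - B * i * (- 1ℚ) ^ j                               ≡⟨ regroup B i ((- 1ℚ) ^ j) ⟩
    - (B * i) * (- 1ℚ) ^ j                             ≡⟨ cong (λ s → - s * (- 1ℚ) ^ j) (recip-inverse j) ⟩
    - 1ℚ * (- 1ℚ) ^ j                                  ∎
    where
    open import Relation.Binary.Reasoning.Setoid (≈-setoid 1)
    A = ℕ→ℚ (suc a)
    B = ℕ→ℚ (suc j)
    i = recip (suc j)
    Zi = Z-recip (ℕ.<-≤-trans (ℕ.m<n+m (suc j) (s≤s z≤n)) (ℕ.≤-reflexive a+j≡p))
    regroup : ∀ B i e → - B * i * e ≡ - (B * i) * e
    regroup = solve-∀ ℚ-ring

  -- Past index M the numerator contains x + M, a multiple of p, while the factorial in the
  -- denominator is prime to p for indices below p.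
  bin-tail : ∀ {x t M} → Z x → Z t → x + ℕ→ℚ M ≡ π * t → ∀ k → suc M ℕ.+ k < p → bin x (suc M ℕ.+ k) ≈[ 1 ] 0ℚ
  bin-tail {x} {t} {M} Zx Zt eq zero lt = subst (λ e → bin x e ≈[ 1 ] 0ℚ) (sym (ℕ.+-identityʳ (suc M)))
    (congruent (b * (t * i)) (Z-* Zb (Z-* Zt (Z-recip M<p))) (trans (cong (λ s → b * (s * i) - 0ℚ) eq) (regroup b π t i)))
    where
    b = bin x M
    i = recip (suc M)
    M<p : suc M < p
    M<p = subst (_< p) (ℕ.+-identityʳ (suc M)) lt
    Zb : Z b
    Zb = Z-bin M (ℕ.<-trans (ℕ.n<1+n M) M<p) Zx
    regroup : ∀ b q t i → b * (q * t * i) - 0ℚ ≡ q * 1ℚ * (b * (t * i))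
    regroup = solve-∀ ℚ-ring
  bin-tail {x} {t} {M} Zx Zt eq (suc k) lt = subst (λ e → bin x e ≈[ 1 ] 0ℚ) (sym (ℕ.+-suc (suc M) k))
    (≈-trans (≈-*ʳ (Z-* (Z-+ Zx (Z-ℕ (suc M ℕ.+ k))) (Z-recip lt′)) (bin-tail Zx Zt eq k (ℕ.<-trans (ℕ.n<1+n _) lt′)))
      (≈-reflexive (*-zeroˡ ((x + ℕ→ℚ (suc M ℕ.+ k)) * recip (suc (suc M ℕ.+ k))))))
    where
    lt′ : suc (suc M ℕ.+ k) < p
    lt′ = subst (_< p) (ℕ.+-suc (suc M) k) lt

  -- Three of the factors contribute one p each; here n > 2 enters.
  cube-≈0 : ∀ {a} j → Z a → a ≈[ 1 ] 0ℚ → a ^ (3 ℕ.+ j) ≈[ 3 ] 0ℚ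
  cube-≈0 {a} j Za (congruent c Zc eq) = congruent (c * (c * (c * a ^ j))) (Z-* Zc (Z-* Zc (Z-* Zc (Z-^ j Za))))
    (trans (cong (λ s → s * (s * (s * a ^ j)) - 0ℚ) (trans (sym (+-identityʳ a)) eq)) (regroup π c (a ^ j)))
    where
    regroup : ∀ q c e → (q * 1ℚ * c) * ((q * 1ℚ * c) * ((q * 1ℚ * c) * e)) - 0ℚ ≡ q * (q * (q * 1ℚ)) * (c * (c * (c * e)))
    regroup = solve-∀ ℚ-ring

  -- The reflection of k to M - k modulo p.

  module Reflection (m M : ℕ) (q+M≡p : suc m ℕ.+ M ≡ p) where

    v : ℕ → ℚ
    v k = bin (ℕ→ℚ (suc m)) k

    h : ℕ → ℚ
    h k = sumTo k (λ j → recip² (suc m ℕ.+ j))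

    r : ℕ → ℚ
    r k = sumTo m (λ j → recip² (suc k ℕ.+ j))

    m<p : m < p
    m<p = subst (m <_) q+M≡p (ℕ.m≤m+n (suc m) M)

    -- By `bin-sym` the denominator may be taken as m! with m < p instead of k!, so k is
    -- unrestricted, as summation of polynomials requires.
    Z-v : ∀ k → Z (v k)
    Z-v k = subst Z (sym (bin-sym m k)) (Z-bin m m<p (Z-ℕ (suc k)))

    Deg-v : Deg (suc m) v
    Deg-v = Deg-cong (λ k → sym (bin-sym m k)) (Deg-bin m)

    -- The numbers inverted are at most q + M - 1 = p - 1.
    Z-h : ∀ {k} → k ≤ M → Z (h k)
    Z-h {k} k≤M = Z-sum k λ j j<k → Z-recip²
      (ℕ.<-≤-trans (ℕ.+-monoʳ-< (suc m) (ℕ.<-≤-trans j<k k≤M)) (ℕ.≤-reflexive q+M≡p))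

    Z-r-0 : Z (r 0)
    Z-r-0 = Z-sum m λ j j<m → Z-recip² (ℕ.≤-<-trans j<m m<p)

    -- Induction on k compares successive ratios: v(l+1)/v(l) = (q+l)/(l+1) and v(k+1)/v(k) =
    -- (q+k)/(k+1). When k + 1 + l = M, q + l ≡ -(k+1) and l + 1 ≡ -(q+k), so the first ratio is the
    -- inverse of the second mod p.
    v-complement : ∀ k l → k ℕ.+ l ≡ M → v l ≈[ 1 ] v M * v k
    v-complement zero l refl = ≈-reflexive (sym (*-identityʳ (v l)))
    v-complement (suc k) l k+l≡M = begin
      v l                                              ≡⟨ *-identityʳ (v l) ⟨
      v l * 1ℚ                                         ≡⟨ cong (v l *_) (recip-inverse k) ⟨
      v l * (ℕ→ℚ (suc k) * i)                          ≈⟨ ≈-*ˡ (Z-v l) (≈-*ʳ Zi (complement {suc k} {suc m ℕ.+ l} eq₁)) ⟩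
      v l * (- ℕ→ℚ (suc m ℕ.+ l) * i)                  ≡⟨ cong (λ s → v l * (- s * i)) (ℕ→ℚ-+ (suc m) l) ⟩
      v l * (- (q + ℕ→ℚ l) * i)                        ≡⟨ regroup₁ (v l) (q + ℕ→ℚ l) i ⟩
      v l * (q + ℕ→ℚ l) * - i                          ≡⟨ cong (_* - i) (bin-suc q l) ⟨
      v (suc l) * ℕ→ℚ (suc l) * - i                    ≈⟨ ≈-*ʳ (Z-neg Zi) (≈-* (Z-v (suc l)) (Z-neg (Z-ℕ (suc m ℕ.+ k))) (v-complement k (suc l) (trans (ℕ.+-suc k l) k+l≡M)) (complement {suc l} {suc m ℕ.+ k} eq₂)) ⟩
      v M * v k * - ℕ→ℚ (suc m ℕ.+ k) * - i            ≡⟨ cong (λ s → v M * v k * - s * - i) (ℕ→ℚ-+ (suc m) k) ⟩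
      v M * v k * - (q + ℕ→ℚ k) * - i                  ≡⟨ regroup₂ (v M) (v k) (q + ℕ→ℚ k) i ⟩
      v M * (v k * ((q + ℕ→ℚ k) * i))                  ∎
      where
      open import Relation.Binary.Reasoning.Setoid (≈-setoid 1)
      q = ℕ→ℚ (suc m)
      i = recip (suc k)
      eq₁ : suc k ℕ.+ (suc m ℕ.+ l) ≡ p
      eq₁ = trans (ℕ.+-comm (suc k) (suc m ℕ.+ l)) (trans (ℕ.+-assoc (suc m) l (suc k))
        (trans (cong (suc m ℕ.+_) (trans (ℕ.+-comm l (suc k)) k+l≡M)) q+M≡p))
      eq₂ : suc l ℕ.+ (suc m ℕ.+ k) ≡ p
      eq₂ = trans (ℕ.+-comm (suc l) (suc m ℕ.+ k)) (trans (ℕ.+-assoc (suc m) k (suc l))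
        (trans (cong (suc m ℕ.+_) (trans (ℕ.+-suc k l) k+l≡M)) q+M≡p))
      Zi : Z i
      Zi = Z-recip (ℕ.<-≤-trans (ℕ.m<m+n (suc k) (s≤s z≤n)) (ℕ.≤-reflexive eq₁))
      regroup₁ : ∀ a s i → a * (- s * i) ≡ a * s * - i
      regroup₁ = solve-∀ ℚ-ring
      regroup₂ : ∀ a b s i → a * b * - s * - i ≡ a * (b * (s * i))
      regroup₂ = solve-∀ ℚ-ring

    -- `v M` ≡ (-1)^M because q + M = p, and the sign hypothesis makes its n-th power 1.
    v^-complement : ∀ n → ((- 1ℚ) ^ M) ^ n ≡ 1ℚ → ∀ k l → k ℕ.+ l ≡ M → v l ^ n ≈[ 1 ] v k ^ n
    v^-complement n sign k l k+l≡M = begin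
      v l ^ n                        ≈⟨ ≈-^ n (Z-v l) (Z-* (Z-v M) (Z-v k)) (v-complement k l k+l≡M) ⟩
      (v M * v k) ^ n                ≡⟨ ^-distrib-* (v M) (v k) n ⟩
      v M ^ n * v k ^ n              ≈⟨ ≈-*ʳ (Z-^ n (Z-v k)) (≈-^ n (Z-v M) (Z-^ M (Z-neg Z-1)) (bin-complement M m q+M≡p)) ⟩
      ((- 1ℚ) ^ M) ^ n * v k ^ n     ≡⟨ cong (_* v k ^ n) sign ⟩
      1ℚ * v k ^ n                   ≡⟨ *-identityˡ (v k ^ n) ⟩
      v k ^ n                        ∎
      where open import Relation.Binary.Reasoning.Setoid (≈-setoid 1)

    -- Both sides sum 1/i² over k + 1 ≤ i ≤ k + m + 1.
    r-step : ∀ k → r k + recip² (suc m ℕ.+ k) ≡ recip² (suc k) + r (suc k)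
    r-step k = begin
      r k + recip² (suc m ℕ.+ k)                                          ≡⟨ cong (λ e → r k + recip² (suc e)) (ℕ.+-comm m k) ⟩
      sumTo (suc m) (λ j → recip² (suc k ℕ.+ j))                          ≡⟨ sumTo-head m (λ j → recip² (suc k ℕ.+ j)) ⟩
      recip² (suc k ℕ.+ 0) + sumTo m (λ j → recip² (suc k ℕ.+ suc j))     ≡⟨ cong₂ (λ e s → recip² e + s) (ℕ.+-identityʳ (suc k)) (sumTo-cong m λ j _ → cong recip² (ℕ.+-suc (suc k) j)) ⟩
      recip² (suc k) + r (suc k)                                          ∎
      where open ≡-Reasoning

    -- As k grows by one and l drops by one, the left side gains 1/(q+k)² and loses a term ≡
    -- 1/(k+1)²; by `r-step` this is also the change of `r k`. The constant is the value of the
    -- difference at k = 0.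
    h-complement : ∀ k l → k ℕ.+ l ≡ M → h k + h l ≈[ 1 ] (h M - r 0) + r k
    h-complement zero l refl = ≈-reflexive (lemma (h l) (r 0))
      where
      lemma : ∀ a b → 0ℚ + a ≡ (a - b) + b
      lemma = solve-∀ ℚ-ring
    h-complement (suc k) l k+l≡M = begin
      h k + R₁ + h l                               ≡⟨ insert (h k) R₁ (h l) R₂ ⟩
      h k + (h l + R₂) + (R₁ + - 1ℚ * R₂)          ≈⟨ ≈-+ (h-complement k (suc l) (trans (ℕ.+-suc k l) k+l≡M)) (≈-+ˡ R₁ (≈-*ˡ (Z-neg Z-1) (recip²-complement eq))) ⟩
      C + r k + (R₁ + - 1ℚ * R₃)                   ≡⟨ regroup C (r k) R₁ R₃ ⟩
      C + (r k + R₁) - R₃                          ≡⟨ cong (λ s → C + s - R₃) (r-step k) ⟩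
      C + (R₃ + r (suc k)) - R₃                    ≡⟨ cancel C R₃ (r (suc k)) ⟩
      C + r (suc k)                                ∎
      where
      open import Relation.Binary.Reasoning.Setoid (≈-setoid 1)
      C = h M - r 0
      R₁ = recip² (suc m ℕ.+ k)
      R₂ = recip² (suc m ℕ.+ l)
      R₃ = recip² (suc k)
      eq : suc m ℕ.+ l ℕ.+ suc k ≡ p
      eq = trans (ℕ.+-assoc (suc m) l (suc k))
        (trans (cong (suc m ℕ.+_) (trans (ℕ.+-comm l (suc k)) k+l≡M)) q+M≡p)
      insert : ∀ a b c d → a + b + c ≡ a + (c + d) + (b + - 1ℚ * d)
      insert = solve-∀ ℚ-ring
      regroup : ∀ a b c d → a + b + (c + - 1ℚ * d) ≡ a + (b + c) - d
      regroup = solve-∀ ℚ-ring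
      cancel : ∀ a b c → a + (b + c) - b ≡ a + c
      cancel = solve-∀ ℚ-ring

    -- For M < k < p the factor `v k` is ≡ 0, so the sum extends to all residues and
    -- `polynomial-sum` applies. One factor `v k` is kept apart from `g` for this.
    truncated-sum : ∀ {N} {g : ℕ → ℚ} → suc N ≡ p → (∀ k → Z (g k)) → Deg N (λ k → v k * g k) →
      sumTo (suc M) (λ k → v k * g k) ≈[ 1 ] 0ℚ
    truncated-sum {N} {g} N+1≡p Zg D = begin
      sumTo (suc M) f                                         ≡⟨ +-identityʳ (sumTo (suc M) f) ⟨
      sumTo (suc M) f + 0ℚ                                    ≈⟨ ≈-+ˡ (sumTo (suc M) f) (≈-sym (≈-sum-0 m tail≈0)) ⟩
      sumTo (suc M) f + sumTo m (λ k → f (suc M ℕ.+ k))       ≡⟨ sumTo-split (suc M) m f ⟨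
      sumTo (suc M ℕ.+ m) f                                   ≡⟨ cong (λ e → sumTo e f) M+q≡p ⟩
      sumTo p f                                               ≈⟨ polynomial-sum N+1≡p (λ k → Z-* (Z-v k) (Zg k)) D ⟩
      0ℚ                                                      ∎
      where
      open import Relation.Binary.Reasoning.Setoid (≈-setoid 1)
      f : ℕ → ℚ
      f k = v k * g k
      M+q≡p : suc M ℕ.+ m ≡ p
      M+q≡p = trans (cong suc (ℕ.+-comm M m)) q+M≡p
      tail≈0 : ∀ k → k < m → f (suc M ℕ.+ k) ≈[ 1 ] 0ℚ
      tail≈0 k k<m = ≈-trans
        (≈-*ʳ (Zg (suc M ℕ.+ k)) (bin-tail (Z-ℕ (suc m)) Z-1
          (trans (sym (ℕ→ℚ-+ (suc m) M)) (trans (cong ℕ→ℚ q+M≡p) (sym (*-identityʳ π)))) k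
          (ℕ.<-≤-trans (ℕ.+-monoʳ-< (suc M) k<m) (ℕ.≤-reflexive M+q≡p))))
        (≈-reflexive (*-zeroˡ (g (suc M ℕ.+ k))))

    -- Folding the sum with k ↦ M - k replaces h k by the polynomial-friendly r k, up to a constant.
    weighted-h-sum : ∀ j → let n = 3 ℕ.+ j in ((- 1ℚ) ^ M) ^ n ≡ 1ℚ → 2 < p → suc (n ℕ.* m) < p →
      sumTo (suc M) (λ k → v k ^ n * h k) ≈[ 1 ] 0ℚ
    weighted-h-sum j sign 2<p size = begin
      S                                               ≡⟨ halve S ⟩
      recip 2 * (S + S)                               ≈⟨ ≈-*ˡ (Z-recip 2<p) double ⟩
      recip 2 * 0ℚ                                    ≡⟨ *-zeroʳ (recip 2) ⟩
      0ℚ                                              ∎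
      where
      open import Relation.Binary.Reasoning.Setoid (≈-setoid 1)
      n = 3 ℕ.+ j
      N = ℕ.pred p
      N+1≡p : suc N ≡ p
      N+1≡p = ℕ.suc-pred p {{ℕ.>-nonZero (ℕ.<-trans (s≤s z≤n) 2<p)}}
      -- The condition p > (q-1)n + 1 enters as the degree bound for sums over all residues.
      deg≤N : suc (n ℕ.* m) ≤ N
      deg≤N = ℕ.≤-pred (subst (suc (n ℕ.* m) <_) (sym N+1≡p) size)
      w : ℕ → ℚ
      w k = v k ^ n
      S = sumTo (suc M) (λ k → w k * h k)
      C = h M - r 0
      halve : ∀ S → S ≡ recip 2 * (S + S)
      halve = solve-∀ ℚ-ring
      Zw : ∀ k → Z (w k)
      Zw k = Z-^ n (Z-v k)
      distrib : ∀ w a b → w * a + w * b ≡ w * (a + b)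
      distrib = solve-∀ ℚ-ring
      expand : ∀ w c r → w * (c + r) ≡ c * w + w * r
      expand = solve-∀ ℚ-ring
      regroup : ∀ v e r → v * (v * (v * e)) * r ≡ v * (e * (v * v * r))
      regroup = solve-∀ ℚ-ring
      -- Of the 3 + j factors `v k`, two absorb the denominators of `r k`, one is reserved for
      -- `truncated-sum`, and j remain in `g`.
      g : ℕ → ℚ
      g k = v k ^ j * binRecip² m k
      wr≡vg : ∀ k → w k * r k ≡ v k * g k
      wr≡vg k = trans (regroup (v k) (v k ^ j) (r k)) (cong (λ s → v k * (v k ^ j * s))
        (trans (cong (λ s → s * s * r k) (bin-sym m k)) (binRecip²-spec m k)))
      Deg-vg : Deg N (λ k → v k * g k)
      Deg-vg = Deg-mono (ℕ.≤-trans (ℕ.≤-reflexive (cong suc deg)) deg≤N)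
        (Deg-* m (j ℕ.* m ℕ.+ (m ℕ.+ m)) Deg-v (Deg-* (j ℕ.* m) (m ℕ.+ m) (Deg-^ m j Deg-v) (Deg-binRecip² m)))
        where
        deg : m ℕ.+ (j ℕ.* m ℕ.+ (m ℕ.+ m)) ≡ n ℕ.* m
        deg = cong (m ℕ.+_) (trans (ℕ.+-comm (j ℕ.* m) (m ℕ.+ m)) (ℕ.+-assoc m m (j ℕ.* m)))
      fold : ∀ k → k < suc M → w k * h k + w (M ∸ k) * h (M ∸ k) ≈[ 1 ] C * w k + w k * r k
      fold k (s≤s k≤M) = begin
        w k * h k + w (M ∸ k) * h (M ∸ k)     ≈⟨ ≈-+ˡ (w k * h k) (≈-*ʳ (Z-h (ℕ.m∸n≤m M k)) (v^-complement n sign k (M ∸ k) (ℕ.m+[n∸m]≡n k≤M))) ⟩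
        w k * h k + w k * h (M ∸ k)           ≡⟨ distrib (w k) (h k) (h (M ∸ k)) ⟩
        w k * (h k + h (M ∸ k))               ≈⟨ ≈-*ˡ (Zw k) (h-complement k (M ∸ k) (ℕ.m+[n∸m]≡n k≤M)) ⟩
        w k * (C + r k)                       ≡⟨ expand (w k) C (r k) ⟩
        C * w k + w k * r k                   ∎
      double : S + S ≈[ 1 ] 0ℚ
      double = begin
        S + S
          ≡⟨ cong (λ s → S + s) (sumTo-reverse M (λ k → w k * h k)) ⟨
        S + sumTo (suc M) (λ k → w (M ∸ k) * h (M ∸ k))
          ≡⟨ sumTo-+ (suc M) (λ k → w k * h k) (λ k → w (M ∸ k) * h (M ∸ k)) ⟨
        sumTo (suc M) (λ k → w k * h k + w (M ∸ k) * h (M ∸ k))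
          ≈⟨ ≈-sum (suc M) fold ⟩
        sumTo (suc M) (λ k → C * w k + w k * r k)
          ≡⟨ sumTo-+ (suc M) (λ k → C * w k) (λ k → w k * r k) ⟩
        sumTo (suc M) (λ k → C * w k) + sumTo (suc M) (λ k → w k * r k)
          ≡⟨ cong₂ _+_ (sumTo-*ˡ (suc M) C w) (sumTo-cong (suc M) λ k _ → wr≡vg k) ⟩
        C * sumTo (suc M) w + sumTo (suc M) (λ k → v k * g k)
          ≈⟨ ≈-+ (≈-*ˡ (Z-minus (Z-h ℕ.≤-refl) Z-r-0) (truncated-sum N+1≡p (λ k → Z-^ (2 ℕ.+ j) (Z-v k)) (Deg-mono deg≤N (Deg-^ m n Deg-v))))
                 (truncated-sum N+1≡p (λ k → Z-* (Z-^ j (Z-v k)) (Z-binRecip² m k m<p)) Deg-vg) ⟩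
        C * 0ℚ + 0ℚ
          ≡⟨ trans (+-identityʳ (C * 0ℚ)) (*-zeroʳ C) ⟩
        0ℚ ∎

  -- Expansion of an n-th power modulo p³.

  triangle : ℕ → ℚ
  triangle zero = 0ℚ
  triangle (suc j) = triangle j + ℕ→ℚ j

  Z-triangle : ∀ j → Z (triangle j)
  Z-triangle zero = Z-0
  Z-triangle (suc j) = Z-+ (Z-triangle j) (Z-ℕ j)

  -- The binomial theorem cut off after the square, `triangle j` being C(j, 2). In each induction
  -- step the only term discarded is -C(j, 2)(pt)³.
  binomial-expansion : ∀ {t} → Z t → ∀ j →
    (1ℚ - π * t) ^ j ≈[ 3 ] 1ℚ - ℕ→ℚ j * (π * t) + triangle j * (π * t * (π * t))
  binomial-expansion {t} Zt zero = ≈-reflexive (lemma (π * t))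
    where
    lemma : ∀ z → 1ℚ ≡ 1ℚ - 0ℚ * z + 0ℚ * (z * z)
    lemma = solve-∀ ℚ-ring
  binomial-expansion {t} Zt (suc j) = begin
    (1ℚ - z) * (1ℚ - z) ^ j                                ≈⟨ ≈-*ˡ (Z-minus Z-1 (Z-* (Z-ℕ p) Zt)) (binomial-expansion Zt j) ⟩
    (1ℚ - z) * (1ℚ - B * z + b * (z * z))                  ≈⟨ congruent (- (b * (t * (t * t)))) (Z-neg (Z-* (Z-triangle j) (Z-* Zt (Z-* Zt Zt)))) (cubic π t B b) ⟩
    1ℚ - (1ℚ + B) * z + (b + B) * (z * z)                  ≡⟨ cong (λ s → 1ℚ - s * z + (b + B) * (z * z)) (ℕ→ℚ-suc j) ⟨
    1ℚ - ℕ→ℚ (suc j) * z + (b + B) * (z * z)               ∎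
    where
    open import Relation.Binary.Reasoning.Setoid (≈-setoid 3)
    z = π * t
    B = ℕ→ℚ j
    b = triangle j
    cubic : ∀ q t B b → (1ℚ - q * t) * (1ℚ - B * (q * t) + b * (q * t * (q * t))) - (1ℚ - (1ℚ + B) * (q * t) + (b + B) * (q * t * (q * t)))
                      ≡ q * (q * (q * 1ℚ)) * - (b * (t * (t * t)))
    cubic = solve-∀ ℚ-ring

  -- As ny = 1, the first-order terms of (U - py)^n and U^(n-1)(U - p) agree. What is left is a
  -- relative correction c p²/U² with c = C(n, 2) y².
  power-expansion : ∀ {u} n′ {y} → suc u < p → Z y → ℕ→ℚ (suc n′) * y ≡ 1ℚ →
    let U = ℕ→ℚ (suc u) in
    (U - π * y) ^ suc n′ ≈[ 3 ] U ^ n′ * (U - π) * (1ℚ + triangle (suc n′) * (y * y) * (π * π) * recip² (suc u))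
  power-expansion {u} n′ {y} u<p Zy ny≡1 = begin
    (U - π * y) ^ n                                                      ≡⟨ cong (_^ n) factor ⟩
    (U * (1ℚ - π * (y * i))) ^ n                                         ≡⟨ ^-distrib-* U (1ℚ - π * (y * i)) n ⟩
    U * E * (1ℚ - π * (y * i)) ^ n                                       ≈⟨ ≈-*ˡ (Z-* (Z-ℕ (suc u)) (Z-^ n′ (Z-ℕ (suc u)))) (binomial-expansion (Z-* Zy Zi) n) ⟩
    U * E * (1ℚ - ℕ→ℚ n * (π * (y * i)) + b * (π * (y * i) * (π * (y * i))))   ≡⟨ regroup₁ U E (ℕ→ℚ n) π y i b ⟩
    U * E * (1ℚ - ℕ→ℚ n * y * (π * i) + b * (y * y) * (π * π) * (i * i))       ≡⟨ cong (λ s → U * E * (1ℚ - s * (π * i) + c * (π * π) * (i * i))) ny≡1 ⟩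
    -- Splitting off 1 - p/U creates only the cross term with c p³/U³.
    U * E * (1ℚ - 1ℚ * (π * i) + c * (π * π) * (i * i))                  ≈⟨ congruent (U * E * (c * (i * (i * i)))) (Z-* (Z-* (Z-ℕ (suc u)) (Z-^ n′ (Z-ℕ (suc u)))) (Z-* (Z-* (Z-triangle n) (Z-* Zy Zy)) (Z-* Zi (Z-* Zi Zi)))) (cubic U E c π i) ⟩
    U * E * ((1ℚ - π * i) * (1ℚ + c * (π * π) * (i * i)))                ≡⟨ regroup₂ U E c π i ⟩
    E * (U - π * (U * i)) * (1ℚ + c * (π * π) * (i * i))                 ≡⟨ cong (λ s → E * (U - π * s) * (1ℚ + c * (π * π) * (i * i))) (recip-inverse u) ⟩
    E * (U - π * 1ℚ) * (1ℚ + c * (π * π) * (i * i))                      ≡⟨ cong (λ s → E * (U - s) * (1ℚ + c * (π * π) * (i * i))) (*-identityʳ π) ⟩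
    E * (U - π) * (1ℚ + c * (π * π) * (i * i))                           ∎
    where
    open import Relation.Binary.Reasoning.Setoid (≈-setoid 3)
    n = suc n′
    U = ℕ→ℚ (suc u)
    E = U ^ n′
    i = recip (suc u)
    b = triangle n
    c = b * (y * y)
    Zi : Z i
    Zi = Z-recip u<p
    split : ∀ U q y i → U - q * y * (U * i) ≡ U * (1ℚ - q * (y * i))
    split = solve-∀ ℚ-ring
    factor : U - π * y ≡ U * (1ℚ - π * (y * i))
    factor = trans (cong (λ s → U - s) (trans (sym (*-identityʳ (π * y))) (cong (π * y *_) (sym (recip-inverse u))))) (split U π y i)
    regroup₁ : ∀ U E n q y i b → U * E * (1ℚ - n * (q * (y * i)) + b * (q * (y * i) * (q * (y * i))))
                               ≡ U * E * (1ℚ - n * y * (q * i) + b * (y * y) * (q * q) * (i * i))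
    regroup₁ = solve-∀ ℚ-ring
    cubic : ∀ U E c q i → U * E * (1ℚ - 1ℚ * (q * i) + c * (q * q) * (i * i)) - U * E * ((1ℚ - q * i) * (1ℚ + c * (q * q) * (i * i)))
                        ≡ q * (q * (q * 1ℚ)) * (U * E * (c * (i * (i * i))))
    cubic = solve-∀ ℚ-ring
    regroup₂ : ∀ U E c q i → U * E * ((1ℚ - q * i) * (1ℚ + c * (q * q) * (i * i)))
                           ≡ E * (U - q * (U * i)) * (1ℚ + c * (q * q) * (i * i))
    regroup₂ = solve-∀ ℚ-ring

  -- The summand modulo p³ for k ≤ M.

  module Expansion (m M : ℕ) (q+M≡p : suc m ℕ.+ M ≡ p) (n′ : ℕ) (y : ℚ) (Zy : Z y) (ny≡1 : ℕ→ℚ (suc n′) * y ≡ 1ℚ) where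

    open Reflection m M q+M≡p

    q : ℚ
    q = ℕ→ℚ (suc m)

    c : ℚ
    c = triangle (suc n′) * (y * y)

    T : ℕ → ℚ
    T k = bin (q - π * y) k ^ suc n′

    -- The main term. As q - p = -M, its second factor is (-1)^k C(M, k).
    W : ℕ → ℚ
    W k = v k ^ n′ * bin (q - π) k

    Z-c : Z c
    Z-c = Z-* (Z-triangle (suc n′)) (Z-* Zy Zy)

    Z-q-πy : Z (q - π * y)
    Z-q-πy = Z-minus (Z-ℕ (suc m)) (Z-* (Z-ℕ p) Zy)

    ≤M⇒<p : ∀ {k} → k ≤ M → k < p
    ≤M⇒<p {k} k≤M = ℕ.<-≤-trans (s≤s (ℕ.≤-trans k≤M (ℕ.m≤n+m M m))) (ℕ.≤-reflexive q+M≡p)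

    Z-W : ∀ {k} → k ≤ M → Z (W k)
    Z-W {k} k≤M = Z-* (Z-^ n′ (Z-v k)) (Z-bin k (≤M⇒<p k≤M) (Z-minus (Z-ℕ (suc m)) (Z-ℕ p)))

    -- Each step contributes one `power-expansion` with U = q + k. The corrections add up, since the
    -- product of c p² h_k and c p²/U² is divisible by p⁴.
    T-expansion : ∀ k → k ≤ M → T k ≈[ 3 ] W k * (1ℚ + c * (π * π) * h k)
    T-expansion zero k≤M = ≈-reflexive (trans (1^ (suc n′)) (trans (lemma c π)
      (cong (λ s → s * 1ℚ * (1ℚ + c * (π * π) * 0ℚ)) (sym (1^ n′)))))
      where
      lemma : ∀ c q → 1ℚ ≡ 1ℚ * 1ℚ * (1ℚ + c * (q * q) * 0ℚ)
      lemma = solve-∀ ℚ-ring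
    T-expansion (suc k) k<M = begin
      (bin (q - π * y) k * ((q - π * y + K) * i)) ^ n
        ≡⟨ cong (λ s → (bin (q - π * y) k * (s * i)) ^ n) (trans (swap q (π * y) K) (cong (λ s → s - π * y) q+k≡U)) ⟩
      (bin (q - π * y) k * ((U - π * y) * i)) ^ n
        ≡⟨ trans (^-distrib-* (bin (q - π * y) k) ((U - π * y) * i) n) (cong (T k *_) (^-distrib-* (U - π * y) i n)) ⟩
      T k * ((U - π * y) ^ n * (i * I))
        ≈⟨ ≈-* (Z-^ n (Z-bin k k<p Z-q-πy)) (Z-* (Z-* (Z-* ZE (Z-minus (Z-ℕ u) (Z-ℕ p))) (Z-+ Z-1 (Z-* Zcππ (Z-* Zρ Zρ)))) (Z-* Zi ZI))
             (T-expansion k k≤M) (≈-*ʳ (Z-* Zi ZI) (power-expansion n′ u<p Zy ny≡1)) ⟩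
      V * B * (1ℚ + c * (π * π) * h k) * (E * (U - π) * (1ℚ + c * (π * π) * (ρ * ρ)) * (i * I))
        ≈⟨ congruent (V * B * E * (U - π) * (i * I) * (π * (c * c * (h k * (ρ * ρ)))))
             (Z-* (Z-* (Z-* (Z-* (Z-W k≤M) ZE) (Z-minus (Z-ℕ u) (Z-ℕ p))) (Z-* Zi ZI)) (Z-* (Z-ℕ p) (Z-* (Z-* Z-c Z-c) (Z-* (Z-h k≤M) (Z-* Zρ Zρ)))))
             (quartic V B E U π i I c (h k) ρ) ⟩
      V * (E * I) * (B * ((U - π) * i)) * (1ℚ + c * (π * π) * (h k + ρ * ρ))
        ≡⟨ cong (λ s → V * s * (B * ((U - π) * i)) * (1ℚ + c * (π * π) * (h k + ρ * ρ))) (^-distrib-* U i n′) ⟨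
      V * (U * i) ^ n′ * (B * ((U - π) * i)) * (1ℚ + c * (π * π) * (h k + ρ * ρ))
        ≡⟨ cong (λ s → s * (B * ((U - π) * i)) * (1ℚ + c * (π * π) * (h k + ρ * ρ))) (^-distrib-* (v k) (U * i) n′) ⟨
      (v k * (U * i)) ^ n′ * (B * ((U - π) * i)) * (1ℚ + c * (π * π) * (h k + ρ * ρ))
        ≡⟨ cong₂ (λ s t → (v k * (s * i)) ^ n′ * (B * (t * i)) * (1ℚ + c * (π * π) * (h k + ρ * ρ))) q+k≡U (trans (swap q π K) (cong (λ s → s - π) q+k≡U)) ⟨
      (v k * ((q + K) * i)) ^ n′ * (B * ((q - π + K) * i)) * (1ℚ + c * (π * π) * (h k + ρ * ρ))
        ∎
      where
      open import Relation.Binary.Reasoning.Setoid (≈-setoid 3)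
      n = suc n′
      u = suc m ℕ.+ k
      K = ℕ→ℚ k
      U = ℕ→ℚ u
      E = U ^ n′
      i = recip (suc k)
      I = i ^ n′
      ρ = recip u
      V = v k ^ n′
      B = bin (q - π) k
      k≤M : k ≤ M
      k≤M = ℕ.≤-trans (ℕ.n≤1+n k) k<M
      k<p : k < p
      k<p = ≤M⇒<p k≤M
      u<p : u < p
      u<p = ℕ.<-≤-trans (ℕ.+-monoʳ-< (suc m) k<M) (ℕ.≤-reflexive q+M≡p)
      q+k≡U : q + K ≡ U
      q+k≡U = sym (ℕ→ℚ-+ (suc m) k)
      Zi : Z i
      Zi = Z-recip (≤M⇒<p k<M)
      ZI : Z I
      ZI = Z-^ n′ Zi
      ZE : Z E
      ZE = Z-^ n′ (Z-ℕ u)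
      Zρ : Z ρ
      Zρ = Z-recip u<p
      Zcππ : Z (c * (π * π))
      Zcππ = Z-* Z-c (Z-* (Z-ℕ p) (Z-ℕ p))
      swap : ∀ a b c → a - b + c ≡ a + c - b
      swap = solve-∀ ℚ-ring
      quartic : ∀ V B E U q i I c h ρ →
        V * B * (1ℚ + c * (q * q) * h) * (E * (U - q) * (1ℚ + c * (q * q) * (ρ * ρ)) * (i * I))
          - V * (E * I) * (B * ((U - q) * i)) * (1ℚ + c * (q * q) * (h + ρ * ρ))
        ≡ q * (q * (q * 1ℚ)) * (V * B * E * (U - q) * (i * I) * (q * (c * c * (h * (ρ * ρ)))))
      quartic = solve-∀ ℚ-ring

    q-π≡-M : q - π ≡ - ℕ→ℚ M
    q-π≡-M = trans (cong (λ s → q - s) (trans (cong ℕ→ℚ (sym q+M≡p)) (ℕ→ℚ-+ (suc m) M))) (cancel q (ℕ→ℚ M))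
      where
      cancel : ∀ a b → a - (a + b) ≡ - b
      cancel = solve-∀ ℚ-ring

    W-sum : n′ ℕ.* m < M → sumTo (suc M) W ≡ 0ℚ
    W-sum deg<M = trans
      (sumTo-cong (suc M) λ k _ → trans (*-comm (v k ^ n′) (bin (q - π) k)) (cong (λ x → bin x k * v k ^ n′) q-π≡-M))
      (alternating-sum M (λ k → v k ^ n′) (Deg-mono deg<M (Deg-^ m n′ Deg-v)))

    -- Mod p the shift of the last factor by p disappears.
    W≈v^ : ∀ {k} → k ≤ M → W k ≈[ 1 ] v k ^ suc n′
    W≈v^ {k} k≤M = ≈-trans
      (≈-*ˡ (Z-^ n′ (Z-v k)) (≈-bin k (≤M⇒<p k≤M) (Z-minus (Z-ℕ (suc m)) (Z-ℕ p)) (Z-ℕ (suc m))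
        (congruent (- 1ℚ) (Z-neg Z-1) (lemma q π))))
      (≈-reflexive (*-comm (v k ^ n′) (v k)))
      where
      lemma : ∀ a q → a - q - a ≡ q * 1ℚ * - 1ℚ
      lemma = solve-∀ ℚ-ring

    T-split : ∀ k → k < suc M → T k ≈[ 3 ] W k + π * π * (c * (v k ^ suc n′ * h k))
    T-split k (s≤s k≤M) = begin
      T k                                                ≈⟨ T-expansion k k≤M ⟩
      W k * (1ℚ + c * (π * π) * h k)                     ≡⟨ expand (W k) c π (h k) ⟩
      W k + π * π * (c * (W k * h k))                    ≈⟨ ≈-+ˡ (W k) (p²-scale (≈-*ˡ Z-c (≈-*ʳ (Z-h k≤M) (W≈v^ k≤M)))) ⟩
      W k + π * π * (c * (v k ^ suc n′ * h k))           ∎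
      where
      open import Relation.Binary.Reasoning.Setoid (≈-setoid 3)
      expand : ∀ w c q h → w * (1ℚ + c * (q * q) * h) ≡ w + q * q * (c * (w * h))
      expand = solve-∀ ℚ-ring

  -- The full sum modulo p³, with y the inverse of n.

  supercongruence : ∀ m M j y → suc m ℕ.+ M ≡ p → Z y → ℕ→ℚ (3 ℕ.+ j) * y ≡ 1ℚ →
    ((- 1ℚ) ^ M) ^ (3 ℕ.+ j) ≡ 1ℚ → 2 < p → suc ((3 ℕ.+ j) ℕ.* m) < p →
    sumTo p (λ k → bin (ℕ→ℚ (suc m) - π * y) k ^ (3 ℕ.+ j)) ≈[ 3 ] 0ℚ
  supercongruence m M j y q+M≡p Zy ny≡1 sign 2<p size = begin
    sumTo p T
      ≡⟨ cong (λ e → sumTo e T) M+q≡p ⟨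
    sumTo (suc M ℕ.+ m) T
      ≡⟨ sumTo-split (suc M) m T ⟩
    sumTo (suc M) T + sumTo m (λ k → T (suc M ℕ.+ k))
      -- Terms with k ≤ M split into main term and correction; the remaining m terms vanish mod p³.
      ≈⟨ ≈-+ (≈-sum (suc M) T-split) (≈-sum-0 m tail≈0) ⟩
    sumTo (suc M) (λ k → W k + π * π * (c * (v k ^ n * h k))) + 0ℚ
      ≡⟨ cong (_+ 0ℚ) (trans (sumTo-+ (suc M) W (λ k → π * π * (c * (v k ^ n * h k))))
           (cong₂ _+_ (W-sum deg<M) (trans (sumTo-*ˡ (suc M) (π * π) (λ k → c * (v k ^ n * h k)))
             (cong (π * π *_) (sumTo-*ˡ (suc M) c (λ k → v k ^ n * h k)))))) ⟩
    0ℚ + π * π * (c * sumTo (suc M) (λ k → v k ^ n * h k)) + 0ℚ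
      ≈⟨ ≈-+ (≈-+ˡ 0ℚ (p²-scale (≈-*ˡ Z-c (weighted-h-sum j sign 2<p size)))) (≈-refl {a = 0ℚ}) ⟩
    0ℚ + π * π * (c * 0ℚ) + 0ℚ
      ≡⟨ collapse π c ⟩
    0ℚ ∎
    where
    open import Relation.Binary.Reasoning.Setoid (≈-setoid 3)
    open Reflection m M q+M≡p
    open Expansion m M q+M≡p (2 ℕ.+ j) y Zy ny≡1
    n = 3 ℕ.+ j
    M+q≡p : suc M ℕ.+ m ≡ p
    M+q≡p = trans (cong suc (ℕ.+-comm M m)) q+M≡p
    -- Cancelling q = m + 1 from nm + 1 < q + M leaves exactly (n-1)m < M.
    deg<M : (2 ℕ.+ j) ℕ.* m < M
    deg<M = ℕ.+-cancelˡ-< (suc m) ((2 ℕ.+ j) ℕ.* m) M (ℕ.<-≤-trans size (ℕ.≤-reflexive (sym q+M≡p)))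
    collapse : ∀ q c → 0ℚ + q * q * (c * 0ℚ) + 0ℚ ≡ 0ℚ
    collapse = solve-∀ ℚ-ring
    regroup : ∀ a b q y → a - q * y + b ≡ (a + b) - q * y
    regroup = solve-∀ ℚ-ring
    factor : ∀ q y → q - q * y ≡ q * (1ℚ - y)
    factor = solve-∀ ℚ-ring
    -- The factor of index M in (q - py)_k, which supplies the cofactor 1 - y for `bin-tail`.
    q-πy+M : q - π * y + ℕ→ℚ M ≡ π * (1ℚ - y)
    q-πy+M = trans (regroup q (ℕ→ℚ M) π y)
      (trans (cong (λ s → s - π * y) (trans (sym (ℕ→ℚ-+ (suc m) M)) (cong ℕ→ℚ q+M≡p))) (factor π y))
    tail≈0 : ∀ k → k < m → T (suc M ℕ.+ k) ≈[ 3 ] 0ℚ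
    tail≈0 k k<m = cube-≈0 j (Z-bin (suc M ℕ.+ k) lt Z-q-πy) (bin-tail Z-q-πy (Z-minus Z-1 Zy) q-πy+M k lt)
      where
      lt : suc M ℕ.+ k < p
      lt = ℕ.<-≤-trans (ℕ.+-monoʳ-< (suc M) k<m) (ℕ.≤-reflexive M+q≡p)

-- Parity and the theorem.

^-even : ∀ {x n} → x * x ≡ 1ℚ → 2 ∣ n → x ^ n ≡ 1ℚ
^-even {x} x²≡1 (divides t refl) = go t
  where
  go : ∀ t → x ^ (t ℕ.* 2) ≡ 1ℚ
  go zero = refl
  go (suc t) = trans (sym (*-assoc x x (x ^ (t ℕ.* 2)))) (cong₂ _*_ x²≡1 (go t))

-1^-square : ∀ M → (- 1ℚ) ^ M * (- 1ℚ) ^ M ≡ 1ℚ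
-1^-square M = trans (sym (^-distrib-* (- 1ℚ) (- 1ℚ) M)) (1^ M)

odd⇒2∣suc : ∀ a → ¬ 2 ∣ a → 2 ∣ suc a
odd⇒2∣suc zero 2∤0 = contradiction (divides 0 refl) 2∤0
odd⇒2∣suc (suc a) 2∤1+a with 2 ∣? a
... | yes 2∣a = ∣m∣n⇒∣m+n ∣-refl 2∣a
... | no 2∤a = contradiction (odd⇒2∣suc a 2∤a) 2∤1+a

-- Both a + 1 and a + b + 1 are even, and b is their difference.
odd+even : ∀ a b → ¬ 2 ∣ a → ¬ 2 ∣ a ℕ.+ b → 2 ∣ b
odd+even a b 2∤a 2∤a+b = ∣m+n∣m⇒∣n (odd⇒2∣suc (a ℕ.+ b) 2∤a+b) (odd⇒2∣suc a 2∤a)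

-- For even n the outer power removes the sign. For odd q, the prime p > 2 is odd, so M = p - q is
-- even and the inner power is already 1.
sign-trivial : ∀ {q M p} n → Prime p → 2 < p → q ℕ.+ M ≡ p → 2 ∣ n ⊎ ¬ 2 ∣ q → ((- 1ℚ) ^ M) ^ n ≡ 1ℚ
sign-trivial {M = M} n _ _ _ (inj₁ 2∣n) = ^-even (-1^-square M) 2∣n
sign-trivial {q} {M} n p-prime 2<p refl (inj₂ 2∤q) = trans (cong (_^ n) (^-even {x = - 1ℚ} refl (odd+even q M 2∤q 2∤p))) (1^ n)
  where
  2∤p : ¬ 2 ∣ q ℕ.+ M
  2∤p 2∣p with prime⇒irreducible p-prime 2∣p
  ... | inj₂ 2≡p = ℕ.<⇒≢ 2<p 2≡p

theorem1p1 : (n q : ℕ) → 2 < n → 0 < q → (2 ∣ n ⊎ ¬ (2 ∣ q)) →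
    (p : ℕ) → Prime p → n ⊔ ((q ∸ 1) Data.Nat.* n Data.Nat.+ 1) < p →
    sumTo p (λ k → (poch (ℕ→ℚ q - (ℕ→ℚ p ÷ ℕ→ℚ n)) k ^ n) ÷ (poch (ℕ→ℚ 1) k ^ n))
    ≡ ℕ→ℚ 0 [mod p ^ 3 ]
theorem1p1 n@(suc (suc (suc j))) q@(suc m) (s≤s (s≤s (s≤s z≤n))) (s≤s z≤n) parity p p-prime bound =
  ≈⇒≡mod (≈-trans (≈-reflexive (sumTo-cong p λ k _ → poch-quotient (ℕ→ℚ q - ℕ→ℚ p ÷ ℕ→ℚ n) n k))
    (supercongruence m (p ∸ q) j (recip n) q+M≡p (Z-recip n<p) (recip-inverse (2 ℕ.+ j))
      (sign-trivial n p-prime 2<p q+M≡p parity) 2<p size))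
  where
  open Localisation p p-prime
  -- The two halves of the maximum serve separately: n < p makes 1/n integral at p, and (q-1)n + 1 <
  -- p bounds the degrees.
  n<p : n < p
  n<p = ℕ.≤-<-trans (ℕ.m≤m⊔n n (m ℕ.* n ℕ.+ 1)) bound
  2<p : 2 < p
  2<p = ℕ.<-trans (s≤s (s≤s (s≤s z≤n))) n<p
  size : suc (n ℕ.* m) < p
  size = subst (_< p) (trans (ℕ.+-comm (m ℕ.* n) 1) (cong suc (ℕ.*-comm m n)))
    (ℕ.≤-<-trans (ℕ.m≤n⊔m n (m ℕ.* n ℕ.+ 1)) bound)
  q+M≡p : q ℕ.+ (p ∸ q) ≡ p
  -- The truncated subtraction is exact because q = m + 1 ≤ nm + 1 < p.
  q+M≡p = ℕ.m+[n∸m]≡n (ℕ.≤-trans (s≤s (ℕ.m≤m+n m ((2 ℕ.+ j) ℕ.* m))) (ℕ.<⇒≤ size))
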